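{- Let $G$ be a connected graph of order $n$ containing at least two cycles, and suppose the circumference (length of a longest cycle) $\ell$ of $G$ satisfies $\ell\geq 6$. Then $trc(G)=2n-7$ if $\ell=6$ and $diam(G)=n-3$; otherwise $trc(G)\leq 2n-9$.
   Context: All graphs are finite, simple and undirected. A total-coloring assigns colors to all vertices and edges; a path is total-rainbow if its edges and internal vertices receive pairwise distinct colors; $trc(G)$ is the minimum number of colors in a total-coloring of the connected graph $G$ such that every two distinct vertices are joined by a total-rainbow path. $diam(G)$ is the diameter of $G$. -}

module Defs where

open import Data.Nat using (ℕ; zero; suc; _≤_; _<_)
open import Data.Fin using (Fin)
open import Data.Bool using (Bool; true; false)
open import Data.List using (List; []; _∷_; length; _++_)
open import Data.List.Relation.Unary.Linked using (Linked)
open import Data.List.Relation.Unary.Unique.Propositional using (Unique)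
open import Data.List.Membership.Propositional using (_∈_)
open import Data.Product using (Σ; _×_; _,_; ∃; ∃-syntax)
open import Data.Sum using (_⊎_)
open import Relation.Binary.PropositionalEquality using (_≡_; _≢_)
open import Relation.Nullary using (¬_)

record Graph (n : ℕ) : Set where
  field
    adj    : Fin n → Fin n → Bool
    sym    : ∀ u v → adj u v ≡ adj v u
    irrefl : ∀ u → adj u u ≡ false
open Graph public

module _ {n : ℕ} (G : Graph n) where

  Adj : Fin n → Fin n → Set
  Adj u v = adj G u v ≡ true

  End : Fin n → List (Fin n) → Fin n → Set
  End u []       v = u ≡ v
  End u (w ∷ ws) v = End w ws v

  -- A path from u to v: vertex sequence u ∷ vs, consecutive vertices adjacent,
  -- all vertices distinct, last vertex v.  Its length (number of edges) is length vs.
  record Path (u v : Fin n) : Set where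
    field
      rest    : List (Fin n)
      linked  : Linked Adj (u ∷ rest)
      unique  : Unique (u ∷ rest)
      ends    : End u rest v
  open Path public

  Connected : Set
  Connected = ∀ u v → Path u v

  Dist : Fin n → Fin n → ℕ → Set
  Dist u v d = (Σ (Path u v) λ P → length (rest P) ≡ d)
             × (∀ (P : Path u v) → d ≤ length (rest P))

  Diam : ℕ → Set
  Diam D = (∀ u v → Σ ℕ λ d → Dist u v d × d ≤ D)
         × (∃[ u ] ∃[ v ] Dist u v D)

  record Cycle : Set where
    field
      start   : Fin n
      others  : List (Fin n)
      long    : 2 ≤ length others
      linked  : Linked Adj (start ∷ others)
      unique  : Unique (start ∷ others)
      lastV   : Fin n
      ends    : End start others lastV
      closes  : Adj lastV start
  open Cycle public

  cycleLength : Cycle → ℕ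
  cycleLength C = suc (length (others C))

  consecPairs : Fin n → List (Fin n) → List (Fin n × Fin n)
  consecPairs u []       = []
  consecPairs u (w ∷ ws) = (u , w) ∷ consecPairs w ws

  cycleEdges : Cycle → List (Fin n × Fin n)
  cycleEdges C = consecPairs (start C) (others C ++ (start C ∷ []))

  CycleEdge : Cycle → Fin n → Fin n → Set
  CycleEdge C u v = ((u , v) ∈ cycleEdges C) ⊎ ((v , u) ∈ cycleEdges C)

  -- G contains at least two (distinct) cycles: two cycles with different edge sets
  AtLeastTwoCycles : Set
  AtLeastTwoCycles = Σ Cycle λ C₁ → Σ Cycle λ C₂ →
    ∃[ u ] ∃[ v ] (CycleEdge C₁ u v × ¬ CycleEdge C₂ u v)

  Circumference : ℕ → Set
  Circumference ℓ = (Σ Cycle λ C → cycleLength C ≡ ℓ)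
                  × (∀ (C : Cycle) → cycleLength C ≤ ℓ)

  -- A total-coloring with (at most) k colors Fin k: vertices and edges are coloured;
  -- edge colours are given by a symmetric function (only values on edges matter).
  record TotalColoring (k : ℕ) : Set where
    field
      vcol    : Fin n → Fin k
      ecol    : Fin n → Fin n → Fin k
      ecolSym : ∀ u v → ecol u v ≡ ecol v u
  open TotalColoring public

  pathColors : ∀ {k} → TotalColoring k → Fin n → List (Fin n) → List (Fin k)
  pathColors c u []            = []
  pathColors c u (w ∷ [])      = ecol c u w ∷ []
  pathColors c u (w ∷ w' ∷ ws) = ecol c u w ∷ vcol c w ∷ pathColors c w (w' ∷ ws)

  TotalRainbow : ∀ {k} → TotalColoring k → ∀ {u v} → Path u v → Set
  TotalRainbow c {u} P = Unique (pathColors c u (rest P))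

  TRConnected : ℕ → Set
  TRConnected k = Σ (TotalColoring k) λ c →
    ∀ u v → u ≢ v → Σ (Path u v) λ P → TotalRainbow c P

  IsTrc : ℕ → Set
  IsTrc t = TRConnected t × (∀ k → k < t → ¬ TRConnected k)

{-# OPTIONS --safe #-}

-- A pendant vertex costs at most two new colours, so a connected subgraph on m vertices with a
-- total-rainbow connecting colouring in 2m − a colours gives trc(G) ≤ 2n − a.  For a = 9 it therefore
-- suffices to find a good subgraph.  A cycle of length ℓ ≥ 9 (with ℓ colours) or 8 (with 7) is one, and so
-- is a heptagon together with a chord or a pendant edge; a graph that is just a heptagon has one cycle.
-- For ℓ = 6 the good subgraphs are a hexagon with an ear, with two tails at non-opposite
-- vertices, with a tail that branches, with a tail at a vertex whose opposite vertex is at distance at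
-- most two, or a graph of diameter two.  If G contains none of them, it is a hexagon with chords and at
-- most two tails, at opposite vertices at distance three, so its diameter is n − 3.  Conversely
-- 2 diam(G) − 1 ≤ trc(G) always, and a hexagon with 5 colours gives trc(G) ≤ 2n − 7.

module Submission where

open import Defs
open import Data.Bool using (Bool; true; false; not; _∧_; _∨_; if_then_else_)
import Data.Bool.Properties as Bool
open import Data.Bool.ListAction using (any)
open import Data.Empty using (⊥; ⊥-elim)
open import Data.Fin using (Fin; zero; suc; toℕ; fromℕ; inject₁; _≟_)
open import Data.Fin.Patterns
open import Data.Fin.Properties using (all?; any?; ¬∀⟶∃¬; suc-injective; toℕ-fromℕ; toℕ-fromℕ<; toℕ-inject₁; toℕ-injective; toℕ<n)
open import Data.Fin.Relation.Unary.Top using (view; ‵fromℕ; ‵inject₁)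
open import Data.List using (List; []; _∷_; _++_; allFin; concatMap; filterᵇ; length; lookup; map; tabulate)
open import Data.List.Properties using (++-identityʳ; length-tabulate; map-++; map-id)
import Data.List.Membership.DecPropositional as DecMembership
open import Data.List.Membership.Propositional using (_∈_; _∉_)
open import Data.List.Membership.Propositional.Properties using (∈-++⁻; ∈-allFin; ∈-lookup; ∈-tabulate⁺; ∈-tabulate⁻)
open import Data.List.Relation.Binary.Permutation.Propositional using (_↭_; ↭⇒↭ₛ; ↭-refl; ↭-sym; ↭-trans; prep; swap)
open import Data.List.Relation.Binary.Permutation.Propositional.Properties using (++⁺ʳ; All-resp-↭; shift; ↭-length; ∈-resp-↭; ∷↭∷ʳ)
open import Data.List.Relation.Binary.Permutation.Setoid.Properties using (Unique-resp-↭)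
open import Data.List.Relation.Unary.All as All using (All; []; _∷_)
import Data.List.Relation.Unary.All.Properties as All
open import Data.List.Relation.Unary.AllPairs using ([]; _∷_)
open import Data.List.Relation.Unary.Any as Any using (Any; here; there)
open import Data.List.Relation.Unary.Linked using (Linked; [-]; _∷_; linked?)
import Data.List.Relation.Unary.Unique.DecPropositional as DecUnique
open import Data.List.Relation.Unary.Unique.Propositional using (Unique)
open import Data.List.Relation.Unary.Unique.Propositional.Properties as Unique using (Unique[x∷xs]⇒x∉xs)
open import Data.Nat using (ℕ; zero; suc; _+_; _*_; _∸_; _≤_; _<_; _≤?_; _<?_; z≤n; s≤s)
open import Data.Nat.DivMod using (_%_; _mod_; %-distribˡ-+; [m+n]%n≡m%n; m%n<n; m%n%n≡m%n; m<n⇒m%n≡m; n%n≡0)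
open import Data.Nat.Properties using
  ( 1+n≰n; *-cancelˡ-≤; *-monoʳ-≤; *-suc; +-assoc; +-cancelˡ-<; +-cancelˡ-≡; +-cancelˡ-≤; +-comm; +-identityʳ
  ; +-mono-<; +-mono-≤; +-monoʳ-≤; +-monoˡ-≤; +-suc; <-cmp; <⇒≢; <⇒≤; m+n∸m≡n; m+n∸n≡m
  ; m≢1+n+m; m≤m+n; m≤n+m; m≤n+o⇒m∸n≤o; m≤n⇒m≤1+n; m≤n⇒∃[o]m+o≡n; n≤0⇒n≡0; n≤1+n; ∸-monoʳ-≤; ≤-<-trans
  ; ≤-antisym; ≤-pred; ≤-refl; ≤-reflexive; ≤-trans; ≮⇒≥; ≰⇒> )
  renaming (suc-injective to ℕ-suc-injective)
open import Data.Nat.Tactic.RingSolver using (solve-∀)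
open import Data.Product using (Σ; ∃; ∃₂; _×_; _,_; proj₁; proj₂)
open import Data.Sum as Sum using (_⊎_; inj₁; inj₂)
open import Data.Vec as Vec using (Vec; []; _∷_)
open import Data.Vec.Functional using () renaming (_∷_ to _◂_)
open import Function using (_∘_; id)
open import Relation.Binary.Definitions using (tri<; tri≈; tri>)
import Relation.Binary.PropositionalEquality as ≡
open ≡ using (_≡_; _≢_; refl; cong; cong₂; subst; trans)
open import Relation.Nullary using (¬_; Dec; yes; no; does; contradiction)
open import Relation.Nullary.Decidable using (True; decidable-stable; toWitness; from-yes; dec-true; dec-false; _×-dec_; _⊎-dec_)

-- A tail can be arbitrarily long, so a branching tail is not a finite pattern. The remedy is a
-- hexagon coloured with two spare colours: it has 7 = 2 * 6 - 5 colours, growing a tail keeps the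
-- deficit 5, and at the tip the reserved colours pay for two leaves at once, which lifts the
-- deficit to 9. Distances are not computed either. A function that changes by at most one along
-- every edge is grown together with the tails, and its values at the two tips certify a distance of
-- at least n - 3. The bound 2n - 9 on trc(G) is decidable, so one may assume that no colouring with
-- 2n - 9 colours exists. Under this assumption every good subgraph turns into the absence of some
-- edge, and rotations and reflections of the cycle reduce the possible edges to a few positions.

private variable
  A : Set
  k k′ m n : ℕ

-- Lists without repetitions

unique-↭ : {xs ys : List A} → xs ↭ ys → Unique xs → Unique ys
unique-↭ p = Unique-resp-↭ (≡.setoid _) (↭⇒↭ₛ p)

∉⇒All≢ : {x : A} {xs : List A} → x ∉ xs → All (x ≢_) xs
∉⇒All≢ x∉ = All.tabulate λ { y∈ refl → x∉ y∈ }

infixr 5 _∷ᵘ_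
_∷ᵘ_ : {x : A} {xs : List A} → x ∉ xs → Unique xs → Unique (x ∷ xs)
x∉ ∷ᵘ u = ∉⇒All≢ x∉ ∷ u

∉-++ : {x : A} (xs : List A) {ys : List A} → x ∉ xs → x ∉ ys → x ∉ xs ++ ys
∉-++ xs p q e with ∈-++⁻ xs e
... | inj₁ e′ = p e′
... | inj₂ e′ = q e′

remove : {x : A} {xs : List A} → x ∈ xs → ∃ λ ys → xs ↭ x ∷ ys
remove (here refl) = _ , ↭-refl
remove {xs = y ∷ _} (there x∈) with remove x∈
... | ys , p = y ∷ ys , ↭-trans (prep y p) (swap _ _ ↭-refl)

unique-⊆⇒length≤ : {xs ys : List A} → Unique xs → (∀ {x} → x ∈ xs → x ∈ ys) → length xs ≤ length ys
unique-⊆⇒length≤ {xs = []} _ _ = z≤n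
unique-⊆⇒length≤ {xs = x ∷ xs} {ys} u@(_ ∷ u′) sub with remove (sub (here refl))
... | zs , p = ≤-trans (s≤s (unique-⊆⇒length≤ u′ λ y∈ → strip y∈ (∈-resp (sub (there y∈)))))
                       (≤-reflexive (≡.sym (↭-length p)))
  where
  ∈-resp : ∀ {y} → y ∈ ys → y ∈ x ∷ zs
  ∈-resp = ∈-resp-↭ p
  strip : ∀ {y} → y ∈ xs → y ∈ x ∷ zs → y ∈ zs
  strip y∈ (here refl) = contradiction y∈ (Unique[x∷xs]⇒x∉xs u)
  strip _  (there y∈)  = y∈

unique⇒length≤ : {xs : List (Fin n)} → Unique xs → length xs ≤ n
unique⇒length≤ {n} u = ≤-trans (unique-⊆⇒length≤ u λ _ → ∈-allFin _) (≤-reflexive (length-tabulate id))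

full⇒≤length : {xs : List (Fin n)} → (∀ x → x ∈ xs) → n ≤ length xs
full⇒≤length {n} full = ≤-trans (≤-reflexive (≡.sym (length-tabulate id))) (unique-⊆⇒length≤ (Unique.allFin⁺ n) λ _ → full _)

joins : (a b u v : Fin n) → Bool
joins a b u v = (does (a ≟ u) ∧ does (b ≟ v)) ∨ (does (a ≟ v) ∧ does (b ≟ u))

joins-comm : (a b u v : Fin n) → joins a b u v ≡ joins a b v u
joins-comm a b u v = Bool.∨-comm (does (a ≟ u) ∧ does (b ≟ v)) _

joins-self : (a b : Fin n) → joins a b a b ≡ true
joins-self a b rewrite dec-true (a ≟ a) refl | dec-true (b ≟ b) refl = refl

joins⇒ : {a b u v : Fin n} → joins a b u v ≡ true → (a ≡ u × b ≡ v) ⊎ (a ≡ v × b ≡ u)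
joins⇒ {a = a} {b} {u} {v} eq with a ≟ u | b ≟ v | a ≟ v | b ≟ u
... | yes p | yes q | _     | _     = inj₁ (p , q)
... | yes _ | no _  | yes p | yes q = inj₂ (p , q)
... | no _  | _     | yes p | yes q = inj₂ (p , q)

joins-avoid : {a u v : Fin n} (b : Fin n) → a ≢ u → a ≢ v → joins a b u v ≡ false
joins-avoid {a = a} {u} {v} b a≢u a≢v rewrite dec-false (a ≟ u) a≢u | dec-false (a ≟ v) a≢v = refl

-- Rainbow walks

module _ {n : ℕ} (G : Graph n) where

  private V = Fin n

  -- The colour list leaves out both end vertices, so reversing a walk merely permutes it.
  data Walk {k} (c : TotalColoring G k) : V → V → List V → List (Fin k) → Set where
    [_] : ∀ {u v} → Adj G u v → Walk c u v (v ∷ []) (ecol c u v ∷ [])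
    _∷_ : ∀ {u w v xs cs} → Adj G u w → Walk c w v xs cs → Walk c u v (w ∷ xs) (ecol c u w ∷ vcol c w ∷ cs)

  -- `S` confines the walk to the part coloured so far, so that it survives when outside vertices
  -- are added. `X` lists further forbidden colours; appending it to `cs` makes them distinct among
  -- themselves as well.
  record Rainbow {k} (c : TotalColoring G k) (S : List V) (X : List (Fin k)) (u v : V) : Set where
    constructor rainbow
    field
      {xs}      : List V
      {cs}      : List (Fin k)
      walk      : Walk c u v xs cs
      simple    : Unique (u ∷ xs)
      inside    : All (_∈ S) (u ∷ xs)
      colourful : Unique (cs ++ X)

  RainbowConnected : ∀ {k} → TotalColoring G k → List V → Set
  RainbowConnected c S = ∀ {u v} → u ∈ S → v ∈ S → u ≢ v → Rainbow c S [] u v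

  -- Colours are reserved for two future pendant edges at r: every vertex reaches r without
  -- the colours vcol r and α, and also without the colours vcol r and β.
  record Forkable (k : ℕ) (S : List V) (r : V) : Set where
    field
      c    : TotalColoring G k
      α β  : Fin k
      α≢β  : α ≢ β
      r≢α  : vcol c r ≢ α
      r≢β  : vcol c r ≢ β
      conn : RainbowConnected c S
      toα  : ∀ {y} → y ∈ S → y ≢ r → Rainbow c S (vcol c r ∷ α ∷ []) y r
      toβ  : ∀ {y} → y ∈ S → y ≢ r → Rainbow c S (vcol c r ∷ β ∷ []) y r

  Adj-sym : ∀ {u v} → Adj G u v → Adj G v u
  Adj-sym {u} {v} a = trans (Graph.sym G v u) a

  Adj⇒≢ : ∀ {u v} → Adj G u v → u ≢ v
  Adj⇒≢ {u} a refl with () ← trans (≡.sym a) (irrefl G u)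

module _ {n : ℕ} {G : Graph n} where

  private V = Fin n

  module _ {k} {c : TotalColoring G k} where

    snoc : ∀ {u v z xs cs} → Walk G c u v xs cs → Adj G v z →
           ∃ λ cs′ → Walk G c u z (xs ++ z ∷ []) cs′ × cs′ ↭ ecol c v z ∷ vcol c v ∷ cs
    snoc [ a ] b = _ , a ∷ [ b ] , ↭-trans (shift _ (_ ∷ _ ∷ []) []) (prep _ (swap _ _ ↭-refl))
    snoc {v = v} {z} (_∷_ {u} {w} a p) b with snoc p b
    ... | _ , q , perm = _ , a ∷ q ,
      ↭-trans (prep _ (prep _ perm)) (↭-sym (shift₂ _ _ (_ ∷ _ ∷ [])))
      where
      shift₂ : ∀ x y (xs : List (Fin k)) {ys} → x ∷ y ∷ xs ++ ys ↭ xs ++ x ∷ y ∷ ys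
      shift₂ x y xs = ↭-sym (↭-trans (shift x xs _) (prep x (shift y xs _)))

    reverse : ∀ {u v xs cs} → Walk G c u v xs cs →
              ∃₂ λ ys ds → Walk G c v u ys ds × v ∷ ys ↭ u ∷ xs × ds ↭ cs
    reverse {u} {v} [ a ] = _ , _ , [ Adj-sym G a ] , swap v u ↭-refl , subst (λ e → e ∷ [] ↭ ecol c u v ∷ []) (ecolSym c u v) ↭-refl
    reverse {u} {v} (_∷_ {w = w} a p) with reverse p
    ... | ys , ds , q , pv , pc with snoc q (Adj-sym G a)
    ... | ds′ , q′ , pc′ = _ , ds′ , q′ ,
          ↭-trans (prep v (↭-sym (∷↭∷ʳ u ys))) (↭-trans (swap v u ↭-refl) (prep u pv)) ,
          ↭-trans pc′ (subst (λ e → e ∷ _ ↭ ecol c u w ∷ _) (ecolSym c u w) (prep _ (prep _ pc)))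

    flip : ∀ {S X u v} → Rainbow G c S X u v → Rainbow G c S X v u
    flip (rainbow p s i d) with reverse p
    ... | _ , _ , q , pv , pc = rainbow q (unique-↭ (↭-sym pv) s) (All-resp-↭ (↭-sym pv) i) (unique-↭ (↭-sym (++⁺ʳ _ pc)) d)

    walk-linked : ∀ {u v xs cs} → Walk G c u v xs cs → Linked (Adj G) (u ∷ xs)
    walk-linked [ a ]   = a ∷ [-]
    walk-linked (a ∷ p) = a ∷ walk-linked p

    walk-end : ∀ {u v xs cs} → Walk G c u v xs cs → End G u xs v
    walk-end [ _ ]   = refl
    walk-end (_ ∷ p) = walk-end p

    walk-colors : ∀ {u v xs cs} → Walk G c u v xs cs → pathColors G c u xs ≡ cs
    walk-colors [ _ ]           = refl
    walk-colors (_ ∷ [ _ ])     = refl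
    walk-colors (_ ∷ p@(_ ∷ _)) = cong (λ cs → _ ∷ _ ∷ cs) (walk-colors p)

    toWalk : ∀ {u v w xs} → Linked (Adj G) (u ∷ w ∷ xs) → End G w xs v → Walk G c u v (w ∷ xs) (pathColors G c u (w ∷ xs))
    toWalk {xs = []}    (a ∷ _) refl = [ a ]
    toWalk {xs = _ ∷ _} (a ∷ l) e    = a ∷ toWalk l e

    walk-length : ∀ {u v xs cs} → Walk G c u v xs cs → suc (length cs) ≡ length xs + length xs
    walk-length [ _ ] = refl
    walk-length {xs = _ ∷ xs} (_ ∷ p) = cong suc (trans (cong suc (walk-length p)) (≡.sym (+-suc _ _)))

    rainbow⇒path : ∀ {S u v} → Rainbow G c S [] u v → Σ (Path G u v) (TotalRainbow G c)
    rainbow⇒path {u = u} (rainbow {xs} {cs} p s _ d) =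
      record { rest = xs ; linked = walk-linked p ; unique = s ; ends = walk-end p } ,
      subst Unique (trans (++-identityʳ cs) (≡.sym (walk-colors p))) d

    full⇒trConnected : ∀ {S} → RainbowConnected G c S → (∀ v → v ∈ S) → TRConnected G k
    full⇒trConnected conn full = c , λ u v u≢v → rainbow⇒path (conn (full u) (full v) u≢v)

module _ {G : Graph m} {G′ : Graph n} {c : TotalColoring G k} {c′ : TotalColoring G′ k′}
         (f : Fin m → Fin n) (π : Fin k′ → Fin k) {S : List (Fin m)}
         (edge : ∀ {a b} → a ∈ S → b ∈ S → Adj G a b → Adj G′ (f a) (f b) × π (ecol c′ (f a) (f b)) ≡ ecol c a b)
         (vertex : ∀ {a} → a ∈ S → π (vcol c′ (f a)) ≡ vcol c a)
  where

  mapWalk : ∀ {u v xs cs} → Walk G c u v xs cs → All (_∈ S) (u ∷ xs) →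
            ∃ λ cs′ → Walk G′ c′ (f u) (f v) (map f xs) cs′ × map π cs′ ≡ cs
  mapWalk [ a ] (u∈ ∷ v∈ ∷ []) = _ , [ proj₁ (edge u∈ v∈ a) ] , cong (_∷ []) (proj₂ (edge u∈ v∈ a))
  mapWalk (a ∷ p) (u∈ ∷ w∈ ∷ xs∈) with mapWalk p (w∈ ∷ xs∈)
  ... | _ , q , eq = _ , proj₁ (edge u∈ w∈ a) ∷ q , cong₂ _∷_ (proj₂ (edge u∈ w∈ a)) (cong₂ _∷_ (vertex w∈) eq)

  -- The colour map `π` runs from the new colours back to the old ones: colours with distinct images
  -- are distinct, so a recolouring may split an old colour but not merge two.
  mapRainbow : (∀ {i j} → f i ≡ f j → i ≡ j) → ∀ {S′ X X′ u v} → (∀ {a} → a ∈ S → f a ∈ S′) → map π X′ ≡ X →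
               Rainbow G c S X u v → Rainbow G′ c′ S′ X′ (f u) (f v)
  mapRainbow inj {X′ = X′} sub refl (rainbow p s i d) with mapWalk p i
  ... | cs′ , q , refl = rainbow q (Unique.map⁺ inj s) (All.map⁺ (All.map sub i))
                                 (Unique.map⁻ {f = π} (subst Unique (≡.sym (map-++ π cs′ X′)) d))

-- Pendant vertices

if-true : {b : Bool} {x y : A} → b ≡ true → (if b then x else y) ≡ x
if-true refl = refl

if-false : {b : Bool} {x y : A} → b ≡ false → (if b then x else y) ≡ y
if-false refl = refl

∈⇒≢ : {x y : A} {S : List A} → x ∉ S → y ∈ S → x ≢ y
∈⇒≢ x∉ y∈ refl = x∉ y∈

-- Shifting the old colours frees `0F` for the vertex that receives a pendant edge and `1F` for the
-- edge itself.
pattern 2+ᶠ i = suc (suc i)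

module _ {n : ℕ} {G : Graph n} where

  private V = Fin n

  widen : ∀ {c : TotalColoring G k} {S S′ X u v} → (∀ {a} → a ∈ S → a ∈ S′) → Rainbow G c S X u v → Rainbow G c S′ X u v
  widen sub (rainbow p s i d) = rainbow p s (All.map sub i) d

  -- The new vertex z takes over the old colour of w, so that z can replace w as the tip of a tail.
  extend : TotalColoring G k → (w z : V) → TotalColoring G (2 + k)
  extend c w z = record
    { vcol    = λ v → if does (v ≟ w) then 0F else 2+ᶠ (vcol c (if does (v ≟ z) then w else v))
    ; ecol    = λ u v → if joins z w u v then 1F else 2+ᶠ (ecol c u v)
    ; ecolSym = λ u v → cong₂ (if_then 1F else_) (joins-comm z w u v) (cong 2+ᶠ (ecolSym c u v))
    }

  module Extend {k} (c : TotalColoring G k) {S : List V} {w z : V} (w∈ : w ∈ S) (z∉ : z ∉ S) (zw : Adj G z w) where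

    c′ : TotalColoring G (2 + k)
    c′ = extend c w z

    2+X : List (Fin k) → List (Fin (2 + k))
    2+X = map 2+ᶠ

    edge-new : ecol c′ z w ≡ 1F
    edge-new = if-true (joins-self z w)

    vertex-w : vcol c′ w ≡ 0F
    vertex-w = if-true (dec-true (w ≟ w) refl)

    vertex-z : vcol c′ z ≡ 2+ᶠ (vcol c w)
    vertex-z = trans (if-false (dec-false (z ≟ w) (∈⇒≢ z∉ w∈))) (cong (2+ᶠ ∘ vcol c) (if-true (dec-true (z ≟ z) refl)))

    vertex-other : ∀ {v} → v ≢ w → v ∈ S → vcol c′ v ≡ 2+ᶠ (vcol c v)
    vertex-other {v} v≢w v∈ = trans (if-false (dec-false (v ≟ w) v≢w))
      (cong (2+ᶠ ∘ vcol c) (if-false (dec-false (v ≟ z) (∈⇒≢ z∉ v∈ ∘ ≡.sym))))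

    edge-old : ∀ {a b} → z ≢ a → z ≢ b → ecol c′ a b ≡ 2+ᶠ (ecol c a b)
    edge-old p q = if-false (joins-avoid w p q)

    -- `0F` returns to the former colour of `w`, the only vertex of `S` that is recoloured. The
    -- value at `1F` is a default: no edge inside `S` has that colour.
    π : Fin (2 + k) → Fin k
    π 0F       = vcol c w
    π 1F       = ecol c z w
    π (2+ᶠ i)  = i

    old : ∀ {X u v} → Rainbow G c S X u v → Rainbow G c′ S (2+X X) u v
    old {X} = mapRainbow id π (λ a∈ b∈ ab → ab , cong π (edge-old (∈⇒≢ z∉ a∈) (∈⇒≢ z∉ b∈))) vertex id id (π-2+ X)
      where
      vertex : ∀ {a} → a ∈ S → π (vcol c′ a) ≡ vcol c a
      vertex {a} a∈ with a ≟ w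
      ... | yes refl = refl
      ... | no _     = cong (vcol c) (if-false (dec-false (a ≟ z) (∈⇒≢ z∉ a∈ ∘ ≡.sym)))
      π-2+ : ∀ X → map π (2+X X) ≡ X
      π-2+ []      = refl
      π-2+ (x ∷ X) = cong (x ∷_) (π-2+ X)

    1∉edge : ∀ {u v} → u ∈ S → v ∈ S → 1F ≢ ecol c′ u v
    1∉edge u∈ v∈ eq with () ← trans eq (edge-old (∈⇒≢ z∉ u∈) (∈⇒≢ z∉ v∈))

    1∉walk : ∀ {u v xs cs} → Walk G c′ u v xs cs → All (_∈ S) (u ∷ xs) → 1F ∉ cs
    1∉walk [ _ ] (u∈ ∷ v∈ ∷ []) (here eq) = 1∉edge u∈ v∈ eq
    1∉walk (_ ∷ _) (u∈ ∷ v∈ ∷ _) (here eq) = 1∉edge u∈ v∈ eq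
    1∉walk (_∷_ {w = v} _ _) _ (there (here eq)) with v ≟ w
    ... | yes _ with () ← eq
    ... | no _  with () ← eq
    1∉walk (_ ∷ p) (_ ∷ i) (there (there e)) = 1∉walk p i e

    0∉edge : ∀ u v → 0F ≢ ecol c′ u v
    0∉edge u v eq with joins z w u v
    ... | true  with () ← eq
    ... | false with () ← eq

    0∉walk : ∀ {u v xs cs} → Walk G c′ u v xs cs → w ∉ xs → 0F ∉ cs
    0∉walk {u} {v} [ _ ] _ (here eq) = 0∉edge u v eq
    0∉walk {u} (_∷_ {w = v} _ _) _ (here eq) = 0∉edge u v eq
    0∉walk (_∷_ {w = v} _ _) w∉ (there (here eq)) with v ≟ w
    ... | yes refl = w∉ (here refl)
    ... | no _     with () ← eq
    0∉walk (_ ∷ p) w∉ (there (there e)) = 0∉walk p (w∉ ∘ there) e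

    0∉2+ : ∀ X → 0F ∉ 2+X X
    0∉2+ (_ ∷ X) (there e) = 0∉2+ X e

    1∉2+ : ∀ X → 1F ∉ 2+X X
    1∉2+ (_ ∷ X) (there e) = 1∉2+ X e

    -- Starting at `z` makes `w` internal, so the colour of `w` begins to count. It is `0F`, which
    -- nothing else on a simple walk carries, and `1F` occurs on the first edge only.
    z-to : ∀ {X y} → Rainbow G c S X w y → Rainbow G c′ (z ∷ S) (2+X X) z y
    z-to {X} r with old r
    ... | rainbow {cs = cs} p s i d = rainbow (zw ∷ p) ((λ z∈ → z∉ (All.lookup i z∈)) ∷ᵘ s) (here refl ∷ All.map there i)
      (subst (λ e → Unique (e ∷ vcol c′ w ∷ cs ++ 2+X X)) (≡.sym edge-new)
        (subst (λ e → Unique (1F ∷ e ∷ cs ++ 2+X X)) (≡.sym vertex-w)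
          ((λ { (there e) → ∉-++ cs (1∉walk p i) (1∉2+ X) e }) ∷ᵘ
            ∉-++ cs (0∉walk p (Unique[x∷xs]⇒x∉xs s)) (0∉2+ X) ∷ᵘ d)))

    z-to-w : ∀ {X} → Unique X → Rainbow G c′ (z ∷ S) (2+X X) z w
    z-to-w {X} u = rainbow [ zw ] ((λ { (here refl) → z∉ w∈ }) ∷ᵘ (λ ()) ∷ᵘ []) (here refl ∷ there w∈ ∷ [])
      (subst (λ e → Unique (e ∷ 2+X X)) (≡.sym edge-new) (1∉2+ X ∷ᵘ Unique.map⁺ (suc-injective ∘ suc-injective) u))

    conn′ : RainbowConnected G c S → RainbowConnected G c′ (z ∷ S)
    conn′ conn (here refl) (here refl) ne = contradiction refl ne
    conn′ conn (there u∈)  (there v∈)  ne = widen there (old (conn u∈ v∈ ne))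
    conn′ conn {v = v} (here refl) (there v∈) ne with v ≟ w
    ... | yes refl = z-to-w []
    ... | no v≢w   = z-to (conn w∈ v∈ (v≢w ∘ ≡.sym))
    conn′ conn {u = u} (there u∈) (here refl) ne with u ≟ w
    ... | yes refl = flip (z-to-w [])
    ... | no u≢w   = flip (z-to (conn w∈ u∈ (u≢w ∘ ≡.sym)))

  module _ {S : List V} {r : V} where

    -- Among the old vertices only `w` changes colour, so `r` and both reserved colours are just
    -- shifted.
    fork-grow-elsewhere : ∀ {w z} → r ∈ S → w ∈ S → z ∉ S → Adj G z w → w ≢ r → Forkable G k S r → Forkable G (2 + k) (z ∷ S) r
    fork-grow-elsewhere {w = w} {z} r∈ w∈ z∉ zw w≢r F = record
      { c = c′ ; α = 2+ᶠ α ; β = 2+ᶠ β ; α≢β = α≢β ∘ suc-injective ∘ suc-injective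
      ; r≢α = r≢α ∘ suc-injective ∘ suc-injective ∘ trans (≡.sym r-col)
      ; r≢β = r≢β ∘ suc-injective ∘ suc-injective ∘ trans (≡.sym r-col)
      ; conn = conn′ conn ; toα = to α toα ; toβ = to β toβ }
      where
      open Forkable F
      open Extend c w∈ z∉ zw
      r-col : vcol c′ r ≡ 2+ᶠ (vcol c r)
      r-col = vertex-other (w≢r ∘ ≡.sym) r∈
      to : ∀ δ → (∀ {y} → y ∈ S → y ≢ r → Rainbow G c S (vcol c r ∷ δ ∷ []) y r) →
           ∀ {y} → y ∈ z ∷ S → y ≢ r → Rainbow G c′ (z ∷ S) (vcol c′ r ∷ 2+ᶠ δ ∷ []) y r
      to δ toδ (here refl) _   = subst (λ e → Rainbow G c′ (z ∷ S) (e ∷ 2+ᶠ δ ∷ []) z r) (≡.sym r-col) (z-to (toδ w∈ w≢r))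
      to δ toδ {y} (there y∈) y≢r = subst (λ e → Rainbow G c′ (z ∷ S) (e ∷ 2+ᶠ δ ∷ []) y r) (≡.sym r-col) (widen there (old (toδ y∈ y≢r)))

    -- The new tip inherits the former colour of `r`. The colours to be avoided are therefore the
    -- old ones shifted, and a walk to `r` that avoids them extends to `z`.
    fork-grow-tip : ∀ {z} → r ∈ S → z ∉ S → Adj G z r → Forkable G k S r → Forkable G (2 + k) (z ∷ S) z
    fork-grow-tip {z = z} r∈ z∉ zr F = record
      { c = c′ ; α = 2+ᶠ α ; β = 2+ᶠ β ; α≢β = α≢β ∘ suc-injective ∘ suc-injective
      ; r≢α = r≢α ∘ suc-injective ∘ suc-injective ∘ trans (≡.sym vertex-z)
      ; r≢β = r≢β ∘ suc-injective ∘ suc-injective ∘ trans (≡.sym vertex-z)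
      ; conn = conn′ conn ; toα = to α r≢α toα ; toβ = to β r≢β toβ }
      where
      open Forkable F
      open Extend c r∈ z∉ zr
      to : ∀ δ → vcol c r ≢ δ → (∀ {y} → y ∈ S → y ≢ r → Rainbow G c S (vcol c r ∷ δ ∷ []) y r) →
           ∀ {y} → y ∈ z ∷ S → y ≢ z → Rainbow G c′ (z ∷ S) (vcol c′ z ∷ 2+ᶠ δ ∷ []) y z
      to δ r≢δ toδ (here refl) ne = contradiction refl ne
      to δ r≢δ toδ {y} (there y∈) ne = subst (λ e → Rainbow G c′ (z ∷ S) (e ∷ 2+ᶠ δ ∷ []) y z) (≡.sym vertex-z) (flip go)
        where
        go : Rainbow G c′ (z ∷ S) (2+X (vcol c r ∷ δ ∷ [])) z y
        go with y ≟ r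
        ... | yes refl = z-to-w ((λ { (here e) → r≢δ e }) ∷ᵘ (λ ()) ∷ᵘ [])
        ... | no y≢r   = z-to (flip (toδ y∈ y≢r))

    -- The edge from `x` is coloured `α`, the one from `y` is coloured `β`. A walk from `x` through
    -- `r` adds `α` and the colour of `r`, exactly what `toα` avoids; likewise for `y`. Two vertices
    -- come without a new colour, so the deficit grows by 4.
    fork : ∀ {x y} → r ∈ S → x ∉ S → y ∉ S → x ≢ y → Adj G x r → Adj G y r → Forkable G k S r →
           ∃ λ (c : TotalColoring G k) → RainbowConnected G c (x ∷ y ∷ S)
    fork {k} {x} {y} r∈ x∉ y∉ x≢y xr yr F = c″ , conn″
      where
      open Forkable F
      c″ : TotalColoring G k
      c″ = record
        { vcol = vcol c
        ; ecol = λ u v → if joins x r u v then α else (if joins y r u v then β else ecol c u v)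
        ; ecolSym = λ u v → cong₂ (if_then α else_) (joins-comm x r u v)
                              (cong₂ (if_then β else_) (joins-comm y r u v) (ecolSym c u v))
        }
      xr-col : ecol c″ x r ≡ α
      xr-col = if-true (joins-self x r)
      yr-col : ecol c″ y r ≡ β
      yr-col = trans (if-false (joins-avoid r x≢y (∈⇒≢ x∉ r∈))) (if-true (joins-self y r))
      old : ∀ {X u v} → Rainbow G c S X u v → Rainbow G c″ S X u v
      old {X} = mapRainbow id id (λ a∈ b∈ ab → ab ,
          trans (if-false (joins-avoid r (∈⇒≢ x∉ a∈) (∈⇒≢ x∉ b∈))) (if-false (joins-avoid r (∈⇒≢ y∉ a∈) (∈⇒≢ y∉ b∈))))
          (λ _ → refl) id id (map-id X)
      S″ = x ∷ y ∷ S
      leaf : ∀ {l δ s} → l ∉ S → l ∈ S″ → Adj G l r → ecol c″ l r ≡ δ → Rainbow G c S (vcol c r ∷ δ ∷ []) s r → Rainbow G c″ S″ [] l s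
      leaf {l} {δ} l∉ l∈ lr refl R with flip (old R)
      ... | rainbow {cs = cs} p s i d = rainbow (lr ∷ p) ((λ e → l∉ (All.lookup i e)) ∷ᵘ s) (l∈ ∷ All.map (there ∘ there) i)
        -- The two reserved colours move from the end of the list to its front, where they are the
        -- colours of the edge at `l` and of `r`.
        (unique-↭ (↭-trans (shift _ cs _) (↭-trans (prep _ (shift _ cs [])) (swap _ _ ↭-refl))) d)
      leafʳ : ∀ {l} → l ∉ S → l ∈ S″ → Adj G l r → Rainbow G c″ S″ [] l r
      leafʳ l∉ l∈ lr = rainbow [ lr ] ((λ { (here refl) → l∉ r∈ }) ∷ᵘ (λ ()) ∷ᵘ []) (l∈ ∷ there (there r∈) ∷ []) ((λ ()) ∷ᵘ [])
      x-to : ∀ {s} → s ∈ S → Rainbow G c″ S″ [] x s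
      x-to {s} s∈ with s ≟ r
      ... | yes refl = leafʳ x∉ (here refl) xr
      ... | no s≢r   = leaf x∉ (here refl) xr xr-col (toα s∈ s≢r)
      y-to : ∀ {s} → s ∈ S → Rainbow G c″ S″ [] y s
      y-to {s} s∈ with s ≟ r
      ... | yes refl = leafʳ y∉ (there (here refl)) yr
      ... | no s≢r   = leaf y∉ (there (here refl)) yr yr-col (toβ s∈ s≢r)
      x-to-y : Rainbow G c″ S″ [] x y
      x-to-y = rainbow (xr ∷ [ Adj-sym G yr ])
        ((λ { (here refl) → x∉ r∈ ; (there (here e)) → x≢y e }) ∷ᵘ (λ { (here refl) → y∉ r∈ }) ∷ᵘ (λ ()) ∷ᵘ [])
        (here refl ∷ there (there r∈) ∷ there (here refl) ∷ [])
        (≡.subst₂ (λ a b → Unique (a ∷ vcol c r ∷ b ∷ [])) (≡.sym xr-col) (trans (≡.sym yr-col) (ecolSym c″ y r))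
          ((λ { (here e) → r≢α (≡.sym e) ; (there (here e)) → α≢β e }) ∷ᵘ (λ { (here e) → r≢β e }) ∷ᵘ (λ ()) ∷ᵘ []))
      conn″ : RainbowConnected G c″ S″
      conn″ (here refl) (here refl) ne = contradiction refl ne
      conn″ (here refl) (there (here refl)) _ = x-to-y
      conn″ (here refl) (there (there v∈)) _ = x-to v∈
      conn″ (there (here refl)) (here refl) _ = flip x-to-y
      conn″ (there (here refl)) (there (here refl)) ne = contradiction refl ne
      conn″ (there (here refl)) (there (there v∈)) _ = y-to v∈
      conn″ (there (there u∈)) (here refl) _ = flip (x-to u∈)
      conn″ (there (there u∈)) (there (here refl)) _ = flip (y-to u∈)
      conn″ (there (there u∈)) (there (there v∈)) ne = widen (there ∘ there) (old (conn u∈ v∈ ne))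

  open DecMembership (_≟_ {n}) using (_∈?_)

  frontier : Connected G → ∀ {S s v} → s ∈ S → v ∉ S → ∃₂ λ z w → z ∉ S × w ∈ S × Adj G z w
  frontier connected {S} {s} {v} s∈ v∉ = go s∈ (linked P) (ends P)
    where
    P = connected s v
    go : ∀ {u xs} → u ∈ S → Linked (Adj G) (u ∷ xs) → End G u xs v → ∃₂ λ z w → z ∉ S × w ∈ S × Adj G z w
    go {xs = []} u∈ _ refl = contradiction u∈ v∉
    go {u} {x ∷ xs} u∈ (a ∷ l) e with x ∈? S
    ... | yes x∈ = go x∈ l e
    ... | no x∉  = x , u , x∉ , u∈ , Adj-sym G a

  full? : ∀ S → (∀ v → v ∈ S) ⊎ ∃ λ v → v ∉ S
  full? S with all? (_∈? S)
  ... | yes full = inj₁ full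
  ... | no ¬full = inj₂ (¬∀⟶∃¬ n (_∈ S) (_∈? S) ¬full)

  -- A pendant vertex raises both `k` and `2 * length S` by two, so the equation persists until `S`
  -- is everything. In `go`, `d` bounds the number of vertices still missing.
  complete : Connected G → ∀ {k a S s} {c : TotalColoring G k} → s ∈ S → Unique S → RainbowConnected G c S →
             k + a ≡ 2 * length S → TRConnected G (2 * n ∸ a)
  complete connected {k} {a} {S} = go n (m≤m+n n (length S))
    where
    go : ∀ d {k S s} {c : TotalColoring G k} → n ≤ d + length S → s ∈ S → Unique S → RainbowConnected G c S →
         k + a ≡ 2 * length S → TRConnected G (2 * n ∸ a)
    go d {k} {S} le s∈ u conn eq with full? S
    ... | inj₁ full = subst (TRConnected G)
                        (trans (≡.sym (m+n∸n≡m k a)) (cong (_∸ a) (trans eq (cong (2 *_) (≤-antisym (unique⇒length≤ u) (full⇒≤length full))))))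
                        (full⇒trConnected conn full)
    go zero le s∈ u conn eq | inj₂ (v , v∉) = contradiction (≤-trans (unique⇒length≤ (v∉ ∷ᵘ u)) le) 1+n≰n
    go (suc d) {k} {S} {c = c} le s∈ u conn eq | inj₂ (v , v∉) with frontier connected s∈ v∉
    ... | z , w , z∉ , w∈ , zw = go d (≤-trans le (≤-reflexive (≡.sym (+-suc d (length S))))) (there s∈) (z∉ ∷ᵘ u)
                                    (Extend.conn′ c w∈ z∉ zw conn) (trans (cong (2 +_) eq) (≡.sym (*-suc 2 (length S))))

-- Coloured patterns

module _ {m n : ℕ} (f : Fin (suc m) → Fin n) where

  -- Sends the vertices outside the image of f to zero.
  preimage : Fin n → Fin (suc m)
  preimage v with any? (λ i → f i ≟ v)
  ... | yes (i , _) = i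
  ... | no _        = zero

  preimage-f : (∀ {i j} → f i ≡ f j → i ≡ j) → ∀ i → preimage (f i) ≡ i
  preimage-f inj i with any? (λ j → f j ≟ f i)
  ... | yes (j , eq) = inj eq
  ... | no ¬∃        = contradiction (i , refl) ¬∃

  module Push {H : Graph (suc m)} {G : Graph n} (inj : ∀ {i j} → f i ≡ f j → i ≡ j)
              (hom : ∀ {i j} → Adj H i j → Adj G (f i) (f j)) {k} (c : TotalColoring H k) where

    pushed : TotalColoring G k
    pushed = record
      { vcol = vcol c ∘ preimage
      ; ecol = λ u v → ecol c (preimage u) (preimage v)
      ; ecolSym = λ u v → ecolSym c _ _ }

    vcol-pushed : ∀ i → vcol pushed (f i) ≡ vcol c i
    vcol-pushed i = cong (vcol c) (preimage-f inj i)

    push : ∀ {S X i j} → Rainbow H c S X i j → Rainbow G pushed (tabulate f) X (f i) (f j)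
    push {X = X} = mapRainbow f id (λ {a} {b} _ _ ab → hom ab , cong₂ (ecol c) (preimage-f inj a) (preimage-f inj b))
                     (λ {a} _ → vcol-pushed a) inj (λ {a} _ → ∈-tabulate⁺ {f = f} a) (map-id X)

    push-connected : (∀ i j → i ≢ j → Rainbow H c (allFin (suc m)) [] i j) → RainbowConnected G pushed (tabulate f)
    push-connected conn u∈ v∈ ne with ∈-tabulate⁻ {f = f} u∈ | ∈-tabulate⁻ {f = f} v∈
    ... | i , refl | j , refl = push (conn i j (ne ∘ cong f))

-- A pattern uses k + 1 colours, so that zero is available as a junk colour for non-edges.
record Pattern (m k : ℕ) : Set where
  field
    vs : Vec (Fin (suc k)) m
    es : List (Fin m × Fin m × Fin (suc k))

does-≟-comm : (i j : Fin n) → does (i ≟ j) ≡ does (j ≟ i)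
does-≟-comm i j with i ≟ j | j ≟ i
... | yes _ | yes _ = refl
... | no _  | no _  = refl
... | yes p | no q  = contradiction (≡.sym p) q
... | no p  | yes q = contradiction (≡.sym q) p

module _ (P : Pattern m k) where
  open Pattern P

  private
    links : (i j : Fin m) → List (Fin m × Fin m × Fin (suc k)) → Bool
    links i j = any (λ (a , b , _) → joins a b i j)

    links-comm : ∀ i j es → links i j es ≡ links j i es
    links-comm i j []                 = refl
    links-comm i j ((a , b , _) ∷ es) = cong₂ _∨_ (joins-comm a b i j) (links-comm i j es)

    colour : (i j : Fin m) → List (Fin m × Fin m × Fin (suc k)) → Fin (suc k)
    colour i j []                 = zero
    colour i j ((a , b , x) ∷ es) = if joins a b i j then x else colour i j es

    colour-comm : ∀ i j es → colour i j es ≡ colour j i es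
    colour-comm i j []                 = refl
    colour-comm i j ((a , b , x) ∷ es) = cong₂ (if_then x else_) (joins-comm a b i j) (colour-comm i j es)

  patternGraph : Graph m
  patternGraph = record
    { adj    = λ i j → not (does (i ≟ j)) ∧ links i j es
    ; sym    = λ i j → cong₂ (λ a b → not a ∧ b) (does-≟-comm i j) (links-comm i j es)
    ; irrefl = λ i → cong (λ a → not a ∧ links i i es) (dec-true (i ≟ i) refl)
    }

  patternColoring : TotalColoring patternGraph (suc k)
  patternColoring = record
    { vcol = Vec.lookup vs ; ecol = λ i j → colour i j es ; ecolSym = λ i j → colour-comm i j es }

  private
    H = patternGraph
    c = patternColoring

  EdgesIn : Graph n → (Fin m → Fin n) → Set
  EdgesIn G f = All (λ (a , b , _) → Adj G (f a) (f b)) es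

  pattern-hom : ∀ {G : Graph n} {f} → EdgesIn G f → ∀ {i j} → Adj H i j → Adj G (f i) (f j)
  pattern-hom {G = G} {f} adjs {i} {j} a = go es adjs (drop-∧ (not (does (i ≟ j))) a)
    where
    drop-∧ : ∀ x {y} → x ∧ y ≡ true → y ≡ true
    drop-∧ true e = e
    go : ∀ es → All (λ (a , b , _) → Adj G (f a) (f b)) es → links i j es ≡ true → Adj G (f i) (f j)
    go ((a , b , _) ∷ es) (ab ∷ adjs) e with joins a b i j in eq
    ... | false = go es adjs e
    ... | true with joins⇒ {a = a} {b} {i} {j} eq
    ...   | inj₁ (refl , refl) = ab
    ...   | inj₂ (refl , refl) = Adj-sym G ab

  Valid : List (Fin (suc k)) → Fin m → Fin m → List (Fin m) → Set
  Valid X i j []       = ⊥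
  Valid X i j (w ∷ ws) = End H w ws j × Unique (i ∷ w ∷ ws) × Unique (pathColors H c i (w ∷ ws) ++ X) × Linked (Adj H) (i ∷ w ∷ ws)

  end? : ∀ i xs j → Dec (End H i xs j)
  end? i []       j = i ≟ j
  end? i (w ∷ ws) j = end? w ws j

  valid? : ∀ X i j xs → Dec (Valid X i j xs)
  valid? X i j []       = no λ ()
  valid? X i j (w ∷ ws) = end? w ws j ×-dec DecUnique.unique? _≟_ (i ∷ w ∷ ws) ×-dec
    DecUnique.unique? _≟_ (pathColors H c i (w ∷ ws) ++ X) ×-dec linked? (λ a b → adj H a b Bool.≟ true) (i ∷ w ∷ ws)

  -- All walks with at most the given number of edges, repetitions of vertices included; `Valid`
  -- sifts them afterwards.
  candidates : ℕ → Fin m → List (List (Fin m))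
  candidates zero    _ = []
  candidates (suc d) i = concatMap (λ w → (w ∷ []) ∷ map (w ∷_) (candidates d w)) (filterᵇ (adj H i) (allFin m))

  Reaches : ℕ → List (Fin (suc k)) → Fin m → Fin m → Set
  Reaches d X i j = i ≡ j ⊎ Any (Valid X i j) (candidates d i)

  reaches? : ∀ d X i j → Dec (Reaches d X i j)
  reaches? d X i j = (i ≟ j) ⊎-dec Any.any? (valid? X i j) (candidates d i)

  reaches⇒rainbow : ∀ {d X i j} → Reaches d X i j → i ≢ j → Rainbow H c (allFin m) X i j
  reaches⇒rainbow (inj₁ eq) ne = contradiction eq ne
  reaches⇒rainbow (inj₂ a)  _  with Any.satisfied a
  ... | w ∷ ws , e , s , d , l = rainbow (toWalk l e) s (All.tabulate λ _ → ∈-allFin _) d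

  connected? : ∀ d → Dec (∀ i j → Reaches d [] i j)
  connected? d = all? λ i → all? λ j → reaches? d [] i j

module _ {n : ℕ} {G : Graph n} (connected : Connected G) where

  -- Evaluating the search to depth `d` settles the implicit argument. The pattern is only a
  -- subgraph: further edges among its vertices leave the rainbow paths intact. With `a` = 9,
  -- patterns on 6, 7 and 8 vertices have 3, 5 and 7 colours.
  use-pattern : (P : Pattern (suc m) k) (d a : ℕ) {_ : True (connected? P d)} (f : Fin (suc m) → Fin n) →
          (∀ {i j} → f i ≡ f j → i ≡ j) →
          EdgesIn P G f → suc k + a ≡ 2 * suc m → TRConnected G (2 * n ∸ a)
  use-pattern P d a {ok} f inj adjs eq =
    complete connected (∈-tabulate⁺ {f = f} zero) (Unique.tabulate⁺ inj)
      (Push.push-connected f inj (pattern-hom P {G = G} adjs) (patternColoring P)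
        (λ i j → reaches⇒rainbow P {d = d} (toWitness ok i j)))
      (trans eq (cong (2 *_) (≡.sym (length-tabulate f))))

-- Found by computer search.  Vertices off the cycle come first, followed by the cycle in order.
octagon : Pattern 8 6
octagon = record
  { vs = 1F ∷ 6F ∷ 1F ∷ 0F ∷ 6F ∷ 1F ∷ 4F ∷ 6F ∷ []
  ; es = (0F , 1F , 3F) ∷ (1F , 2F , 2F) ∷ (2F , 3F , 4F) ∷ (3F , 4F , 5F) ∷
         (4F , 5F , 3F) ∷ (5F , 6F , 2F) ∷ (6F , 7F , 0F) ∷ (7F , 0F , 5F) ∷ [] }

hexagon : Pattern 6 4
hexagon = record
  { vs = 1F ∷ 1F ∷ 0F ∷ 2F ∷ 4F ∷ 1F ∷ []
  ; es = (0F , 1F , 2F) ∷ (1F , 2F , 4F) ∷ (2F , 3F , 3F) ∷ (3F , 4F , 1F) ∷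
         (4F , 5F , 0F) ∷ (5F , 0F , 3F) ∷ [] }

heptagon-tail : Pattern 8 6
heptagon-tail = record
  { vs = 2F ∷ 2F ∷ 6F ∷ 3F ∷ 5F ∷ 2F ∷ 1F ∷ 6F ∷ []
  ; es = (1F , 2F , 1F) ∷ (2F , 3F , 4F) ∷ (3F , 4F , 0F) ∷ (4F , 5F , 6F) ∷
         (5F , 6F , 4F) ∷ (6F , 7F , 3F) ∷ (7F , 1F , 0F) ∷ (0F , 1F , 5F) ∷ [] }

heptagon-chord₂ : Pattern 7 4
heptagon-chord₂ = record
  { vs = 1F ∷ 3F ∷ 1F ∷ 2F ∷ 0F ∷ 2F ∷ 3F ∷ []
  ; es = (0F , 1F , 2F) ∷ (1F , 2F , 0F) ∷ (2F , 3F , 4F) ∷ (3F , 4F , 3F) ∷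
         (4F , 5F , 1F) ∷ (5F , 6F , 4F) ∷ (6F , 0F , 0F) ∷ (0F , 2F , 4F) ∷ [] }

heptagon-chord₃ : Pattern 7 4
heptagon-chord₃ = record
  { vs = 4F ∷ 1F ∷ 3F ∷ 2F ∷ 1F ∷ 3F ∷ 1F ∷ []
  ; es = (0F , 1F , 3F) ∷ (1F , 2F , 0F) ∷ (2F , 3F , 3F) ∷ (3F , 4F , 0F) ∷
         (4F , 5F , 4F) ∷ (5F , 6F , 2F) ∷ (6F , 0F , 0F) ∷ (0F , 3F , 1F) ∷ [] }

hexagon-ear₁ : Pattern 7 4
hexagon-ear₁ = record
  { vs = 4F ∷ 0F ∷ 4F ∷ 2F ∷ 4F ∷ 1F ∷ 2F ∷ []
  ; es = (1F , 2F , 2F) ∷ (2F , 3F , 1F) ∷ (3F , 4F , 3F) ∷ (4F , 5F , 0F) ∷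
         (5F , 6F , 4F) ∷ (6F , 1F , 3F) ∷ (0F , 1F , 1F) ∷ (0F , 2F , 0F) ∷ [] }

hexagon-ear₂ : Pattern 7 4
hexagon-ear₂ = record
  { vs = 0F ∷ 2F ∷ 0F ∷ 3F ∷ 0F ∷ 4F ∷ 3F ∷ []
  ; es = (1F , 2F , 4F) ∷ (2F , 3F , 4F) ∷ (3F , 4F , 1F) ∷ (4F , 5F , 2F) ∷
         (5F , 6F , 0F) ∷ (6F , 1F , 1F) ∷ (0F , 1F , 3F) ∷ (0F , 3F , 4F) ∷ [] }

hexagon-ear₃ : Pattern 7 4
hexagon-ear₃ = record
  { vs = 0F ∷ 0F ∷ 2F ∷ 2F ∷ 0F ∷ 0F ∷ 4F ∷ []
  ; es = (1F , 2F , 3F) ∷ (2F , 3F , 4F) ∷ (3F , 4F , 3F) ∷ (4F , 5F , 4F) ∷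
         (5F , 6F , 2F) ∷ (6F , 1F , 1F) ∷ (0F , 1F , 2F) ∷ (0F , 4F , 1F) ∷ [] }

hexagon-tails₁ : Pattern 8 6
hexagon-tails₁ = record
  { vs = 4F ∷ 2F ∷ 1F ∷ 6F ∷ 2F ∷ 0F ∷ 5F ∷ 3F ∷ []
  ; es = (2F , 3F , 4F) ∷ (3F , 4F , 3F) ∷ (4F , 5F , 1F) ∷ (5F , 6F , 4F) ∷
         (6F , 7F , 6F) ∷ (7F , 2F , 0F) ∷ (1F , 2F , 2F) ∷ (0F , 3F , 5F) ∷ [] }

hexagon-tails₂ : Pattern 8 6
hexagon-tails₂ = record
  { vs = 5F ∷ 1F ∷ 1F ∷ 6F ∷ 3F ∷ 2F ∷ 0F ∷ 5F ∷ []
  ; es = (2F , 3F , 4F) ∷ (3F , 4F , 0F) ∷ (4F , 5F , 1F) ∷ (5F , 6F , 4F) ∷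
         (6F , 7F , 6F) ∷ (7F , 2F , 3F) ∷ (1F , 2F , 2F) ∷ (0F , 4F , 5F) ∷ [] }

-- Three paths of three edges between the same two vertices. All cycles in it have six edges, so the
-- circumference cannot exclude it.
hexagon-long-ear : Pattern 8 6
hexagon-long-ear = record
  { vs = 4F ∷ 3F ∷ 0F ∷ 3F ∷ 0F ∷ 0F ∷ 5F ∷ 6F ∷ []
  ; es = (2F , 3F , 4F) ∷ (3F , 4F , 2F) ∷ (4F , 5F , 2F) ∷ (5F , 6F , 3F) ∷
         (6F , 7F , 1F) ∷ (7F , 2F , 2F) ∷ (1F , 2F , 5F) ∷ (0F , 5F , 1F) ∷
         (1F , 0F , 6F) ∷ [] }

hexagon-03-tail : Pattern 7 4
hexagon-03-tail = record
  { vs = 1F ∷ 4F ∷ 1F ∷ 1F ∷ 0F ∷ 0F ∷ 3F ∷ []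
  ; es = (1F , 2F , 0F) ∷ (2F , 3F , 2F) ∷ (3F , 4F , 3F) ∷ (4F , 5F , 2F) ∷
         (5F , 6F , 1F) ∷ (6F , 1F , 2F) ∷ (0F , 1F , 3F) ∷ (1F , 4F , 1F) ∷ [] }

hexagon-02-tail : Pattern 7 4
hexagon-02-tail = record
  { vs = 4F ∷ 0F ∷ 3F ∷ 3F ∷ 1F ∷ 4F ∷ 3F ∷ []
  ; es = (1F , 2F , 2F) ∷ (2F , 3F , 4F) ∷ (3F , 4F , 2F) ∷ (4F , 5F , 0F) ∷
         (5F , 6F , 1F) ∷ (6F , 1F , 2F) ∷ (0F , 1F , 4F) ∷ (1F , 3F , 1F) ∷ [] }

hexagon-13-tail : Pattern 7 4
hexagon-13-tail = record
  { vs = 3F ∷ 0F ∷ 1F ∷ 4F ∷ 0F ∷ 4F ∷ 4F ∷ []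
  ; es = (1F , 2F , 4F) ∷ (2F , 3F , 2F) ∷ (3F , 4F , 1F) ∷ (4F , 5F , 3F) ∷
         (5F , 6F , 2F) ∷ (6F , 1F , 1F) ∷ (0F , 1F , 3F) ∷ (2F , 4F , 2F) ∷ [] }

-- Three colours allow rainbow paths of at most two edges, since three edges and two internal
-- vertices would take five. So the chords must bring the diameter down to two. In the last of these
-- four patterns they turn the hexagon into the complete bipartite graph on 3 + 3 vertices.
hexagon-02-13 : Pattern 6 2
hexagon-02-13 = record
  { vs = 0F ∷ 2F ∷ 1F ∷ 1F ∷ 0F ∷ 0F ∷ []
  ; es = (0F , 1F , 1F) ∷ (1F , 2F , 0F) ∷ (2F , 3F , 0F) ∷ (3F , 4F , 2F) ∷
         (4F , 5F , 1F) ∷ (5F , 0F , 2F) ∷ (0F , 2F , 1F) ∷ (1F , 3F , 0F) ∷ [] }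

hexagon-02-04 : Pattern 6 2
hexagon-02-04 = record
  { vs = 0F ∷ 1F ∷ 0F ∷ 1F ∷ 2F ∷ 2F ∷ []
  ; es = (0F , 1F , 2F) ∷ (1F , 2F , 1F) ∷ (2F , 3F , 2F) ∷ (3F , 4F , 0F) ∷
         (4F , 5F , 1F) ∷ (5F , 0F , 1F) ∷ (0F , 2F , 2F) ∷ (0F , 4F , 1F) ∷ [] }

hexagon-02-14 : Pattern 6 2
hexagon-02-14 = record
  { vs = 1F ∷ 2F ∷ 2F ∷ 2F ∷ 2F ∷ 0F ∷ []
  ; es = (0F , 1F , 0F) ∷ (1F , 2F , 0F) ∷ (2F , 3F , 1F) ∷ (3F , 4F , 0F) ∷
         (4F , 5F , 1F) ∷ (5F , 0F , 2F) ∷ (0F , 2F , 0F) ∷ (1F , 4F , 1F) ∷ [] }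

hexagon-03-14-25 : Pattern 6 2
hexagon-03-14-25 = record
  { vs = 1F ∷ 1F ∷ 0F ∷ 2F ∷ 2F ∷ 1F ∷ []
  ; es = (0F , 1F , 1F) ∷ (1F , 2F , 1F) ∷ (2F , 3F , 0F) ∷ (3F , 4F , 1F) ∷
         (4F , 5F , 2F) ∷ (5F , 0F , 0F) ∷ (0F , 3F , 2F) ∷ (1F , 4F , 0F) ∷
         (2F , 5F , 2F) ∷ [] }

-- Cycles

module _ {m : ℕ} where

  private ℓ = suc m

  toℕ-mod : ∀ p → toℕ (p mod ℓ) ≡ p % ℓ
  toℕ-mod p = toℕ-fromℕ< (m%n<n p ℓ)

  mod-cong : ∀ p q → p % ℓ ≡ q % ℓ → p mod ℓ ≡ q mod ℓ
  mod-cong p q eq = toℕ-injective (trans (toℕ-mod p) (trans eq (≡.sym (toℕ-mod q))))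

  mod-toℕ : (i : Fin ℓ) → toℕ i mod ℓ ≡ i
  mod-toℕ i = toℕ-injective (trans (toℕ-mod (toℕ i)) (m<n⇒m%n≡m (toℕ<n i)))

  %-+ˡ : ∀ p q → (p % ℓ + q) % ℓ ≡ (p + q) % ℓ
  %-+ˡ p q = trans (%-distribˡ-+ (p % ℓ) q ℓ) (trans (cong (λ x → (x + q % ℓ) % ℓ) (m%n%n≡m%n p ℓ)) (≡.sym (%-distribˡ-+ p q ℓ)))

  %-+ʳ : ∀ p q → (p + q % ℓ) % ℓ ≡ (p + q) % ℓ
  %-+ʳ p q = trans (cong (_% ℓ) (+-comm p (q % ℓ))) (trans (%-+ˡ q p) (cong (_% ℓ) (+-comm q p)))

  -- Let r be the remainder of `p`. If r + `suc s` stays below `ℓ`, it is the new remainder and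
  -- exceeds r; otherwise the new remainder is r + `suc s` - `ℓ`, and equality with r would give
  -- `suc s` = `ℓ`.
  %-shift : ∀ p s → suc s < ℓ → p % ℓ ≢ (p + suc s) % ℓ
  %-shift p s s<ℓ eq with p % ℓ + suc s <? ℓ
  ... | yes lt = <⇒≢ (m<m+n′ (p % ℓ) s) (trans eq (trans (≡.sym (%-+ˡ p (suc s))) (m<n⇒m%n≡m lt)))
    where
    m<m+n′ : ∀ a b → a < a + suc b
    m<m+n′ a b = ≤-trans (s≤s (m≤m+n a b)) (≤-reflexive (≡.sym (+-suc a b)))
  ... | no ge with m≤n⇒∃[o]m+o≡n (≮⇒≥ ge)
  ...   | x , ℓ+x≡ = <⇒≢ s<ℓ (+-cancelˡ-≡ x (suc s) ℓ (trans (cong (_+ suc s) (≡.sym r≡x)) (trans (≡.sym ℓ+x≡) (+-comm ℓ x))))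
    where
    x<ℓ : x < ℓ
    x<ℓ = +-cancelˡ-< ℓ x ℓ (subst (_< ℓ + ℓ) (≡.sym ℓ+x≡) (+-mono-< (m%n<n p ℓ) s<ℓ))
    r≡x : p % ℓ ≡ x
    r≡x = trans eq (trans (≡.sym (%-+ˡ p (suc s))) (trans (cong (_% ℓ) (trans (≡.sym ℓ+x≡) (+-comm ℓ x)))
            (trans ([m+n]%n≡m%n x ℓ) (m<n⇒m%n≡m x<ℓ))))

  next : Fin ℓ → Fin ℓ
  next i = suc (toℕ i) mod ℓ

  next-mod : ∀ p → next (p mod ℓ) ≡ suc p mod ℓ
  next-mod p = mod-cong (suc (toℕ (p mod ℓ))) (suc p) (trans (cong (λ x → suc x % ℓ) (toℕ-mod p)) (%-+ʳ 1 p))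

  rotate : Fin ℓ → Fin ℓ → Fin ℓ
  rotate s i = (toℕ s + toℕ i) mod ℓ

  rotate-next : ∀ s i → rotate s (next i) ≡ next (rotate s i)
  rotate-next s i = trans (mod-cong (toℕ s + toℕ (next i)) (suc (toℕ s + toℕ i)) (trans (cong (λ x → (toℕ s + x) % ℓ) (toℕ-mod (suc (toℕ i))))
    (trans (%-+ʳ (toℕ s) (suc (toℕ i))) (cong (_% ℓ) (+-suc (toℕ s) (toℕ i)))))) (≡.sym (next-mod (toℕ s + toℕ i)))

  mod-inj : ∀ p q → p mod ℓ ≡ q mod ℓ → p % ℓ ≡ q % ℓ
  mod-inj p q eq = trans (≡.sym (toℕ-mod p)) (trans (cong toℕ eq) (toℕ-mod q))

  rotate-apart : ∀ s i j → toℕ i < toℕ j → rotate s i ≢ rotate s j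
  rotate-apart s i j i<j eq with m≤n⇒∃[o]m+o≡n i<j
  ... | d , eqd = %-shift (toℕ s + toℕ i) d
      (≤-<-trans (≤-trans (m≤n+m (suc d) (toℕ i)) (≤-reflexive i+1+d≡j)) (toℕ<n j))
      (trans (mod-inj (toℕ s + toℕ i) (toℕ s + toℕ j) eq) (cong (_% ℓ) (trans (cong (toℕ s +_) (≡.sym i+1+d≡j)) (≡.sym (+-assoc (toℕ s) (toℕ i) (suc d))))))
    where
    i+1+d≡j : toℕ i + suc d ≡ toℕ j
    i+1+d≡j = trans (+-suc (toℕ i) d) eqd

  rotate-injective : ∀ s {i j} → rotate s i ≡ rotate s j → i ≡ j
  rotate-injective s {i} {j} eq with <-cmp (toℕ i) (toℕ j)
  ... | tri< i<j _ _ = contradiction eq (rotate-apart s i j i<j)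
  ... | tri≈ _ i≡j _ = toℕ-injective i≡j
  ... | tri> _ _ j<i = contradiction (≡.sym eq) (rotate-apart s j i j<i)

  rotate-zero : ∀ s → rotate s zero ≡ s
  rotate-zero s = trans (cong (_mod ℓ) (+-identityʳ (toℕ s))) (mod-toℕ s)

  -- A window of consecutive residues, used both for the vertices of an arc and for its colours.
  segment : ℕ → ℕ → List (Fin ℓ)
  segment zero    p = []
  segment (suc e) p = p mod ℓ ∷ segment e (suc p)

  ∈-segment : ∀ {e p x} → x ∈ segment e p → ∃ λ s → s < e × x ≡ (p + s) mod ℓ
  ∈-segment {suc e} {p} (here refl) = 0 , s≤s z≤n , cong (_mod ℓ) (≡.sym (+-identityʳ p))
  ∈-segment {suc e} {p} (there x∈) with ∈-segment {e} x∈
  ... | s , s<e , refl = suc s , s≤s s<e , cong (_mod ℓ) (≡.sym (+-suc p s))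

  segment-unique : ∀ e p → e ≤ ℓ → Unique (segment e p)
  segment-unique zero    p _   = []
  segment-unique (suc e) p e<ℓ = fresh ∷ᵘ segment-unique e (suc p) (<⇒≤ e<ℓ)
    where
    fresh : p mod ℓ ∉ segment e (suc p)
    fresh x∈ with ∈-segment {e} x∈
    ... | s , s<e , eq = %-shift p s (≤-<-trans s<e e<ℓ) (trans (mod-inj p (suc p + s) eq) (cong (_% ℓ) (≡.sym (+-suc p s))))

-- A cycle is parametrised by residues, so that rotating or reflecting it is a precomposition.
record Ring {n} (G : Graph n) {m} (h : Fin (suc m) → Fin n) : Set where
  field
    inj  : ∀ {i j} → h i ≡ h j → i ≡ j
    step : ∀ i → Adj G (h i) (h (next i))

lookup-injective : ∀ {A : Set} {xs : List A} → Unique xs → ∀ {i j} → lookup xs i ≡ lookup xs j → i ≡ j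
lookup-injective {xs = _ ∷ _} _       {zero}  {zero}  _  = refl
lookup-injective {xs = _ ∷ _} (_ ∷ u) {suc i} {suc j} eq = cong suc (lookup-injective u eq)
lookup-injective {xs = _ ∷ xs} u {zero} {suc j} eq = contradiction (subst (_∈ xs) (≡.sym eq) (∈-lookup j)) (Unique[x∷xs]⇒x∉xs u)
lookup-injective {xs = _ ∷ xs} u {suc i} {zero} eq = contradiction (subst (_∈ xs) eq (∈-lookup i)) (Unique[x∷xs]⇒x∉xs u)

module _ {n : ℕ} {G : Graph n} where

  ring-rotate : ∀ {m} {h : Fin (suc m) → Fin n} s → Ring G h → Ring G (h ∘ rotate s)
  ring-rotate {h = h} s R = record
    { inj  = rotate-injective s ∘ inj
    ; step = λ i → subst (λ j → Adj G (h (rotate s i)) (h j)) (≡.sym (rotate-next s i)) (step (rotate s i)) }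
    where open Ring R

  cycle-ring : (C : Cycle G) → Ring G (lookup (start C ∷ others C))
  cycle-ring C = record { inj = lookup-injective (unique C) ; step = step }
    where
    vs = start C ∷ others C
    len = length (others C)
    lookup-linked : ∀ {x xs} → Linked (Adj G) (x ∷ xs) → (i : Fin (length xs)) →
                    Adj G (lookup (x ∷ xs) (inject₁ i)) (lookup (x ∷ xs) (suc i))
    lookup-linked (a ∷ _) zero    = a
    lookup-linked (_ ∷ l) (suc i) = lookup-linked l i
    lookup-last : ∀ x xs {v} → End G x xs v → lookup (x ∷ xs) (fromℕ (length xs)) ≡ v
    lookup-last x []       e = e
    lookup-last x (y ∷ ys) e = lookup-last y ys e
    step : ∀ i → Adj G (lookup vs i) (lookup vs (next i))
    step i with view i
    ... | ‵fromℕ = ≡.subst₂ (λ a j → Adj G a (lookup vs j)) (≡.sym (lookup-last (start C) (others C) (ends C))) (≡.sym next-last) (closes C)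
      where
      next-last : next (fromℕ len) ≡ zero
      next-last = toℕ-injective (trans (toℕ-mod (suc (toℕ (fromℕ len))))
        (trans (cong (λ x → suc x % suc len) (toℕ-fromℕ len)) (n%n≡0 (suc len))))
    ... | ‵inject₁ j = subst (λ x → Adj G (lookup vs (inject₁ j)) (lookup vs x)) (≡.sym next-inject₁) (lookup-linked (linked C) j)
      where
      next-inject₁ : next (inject₁ j) ≡ suc j
      next-inject₁ = toℕ-injective (trans (toℕ-mod (suc (toℕ (inject₁ j))))
        (trans (cong (λ x → suc x % suc len) (toℕ-inject₁ j)) (m<n⇒m%n≡m (s≤s (toℕ<n j)))))

pullback : Graph n → (Fin m → Fin n) → Graph m
pullback G f = record
  { adj = λ i j → adj G (f i) (f j) ; sym = λ i j → Graph.sym G (f i) (f j) ; irrefl = λ i → irrefl G (f i) }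

-- Cyclic colouring of a ring

module CyclicColouring {m} {H : Graph (suc m)} (step : ∀ i → Adj H i (next i)) where

  private ℓ = suc m

  -- Vertices and edges are coloured alternately 0, 1, 2, … modulo ℓ around the cycle,
  -- so any ℓ consecutive elements have distinct colours.
  cyclic : TotalColoring H ℓ
  cyclic = record
    { vcol = λ i → (toℕ i + toℕ i) mod ℓ
    ; ecol = λ i j → (toℕ i + toℕ j) mod ℓ
    ; ecolSym = λ i j → cong (_mod ℓ) (+-comm (toℕ i) (toℕ j)) }

  +-mod : ∀ p q → (toℕ (p mod ℓ) + toℕ (q mod ℓ)) mod ℓ ≡ (p + q) mod ℓ
  +-mod p q = mod-cong (toℕ (p mod ℓ) + toℕ (q mod ℓ)) (p + q) (trans (≡.cong₂ (λ x y → (x + y) % ℓ) (toℕ-mod p) (toℕ-mod q)) (≡.sym (%-distribˡ-+ p q ℓ)))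

  -- The edge from p to p + 1 has colour 2p + 1 and the vertex p + 1 has colour 2p + 2, so an arc of
  -- d + 1 edges shows the 2d + 1 consecutive colours from 2p + 1 on.
  arc : ∀ d p → Walk H cyclic (p mod ℓ) ((suc d + p) mod ℓ) (segment (suc d) (suc p)) (segment (suc (d + d)) (suc (p + p)))
  arc zero p = subst (λ e → Walk H cyclic (p mod ℓ) (suc p mod ℓ) (suc p mod ℓ ∷ []) (e ∷ [])) (trans (+-mod p (suc p)) (cong (_mod ℓ) (+-suc p p)))
                 [ subst (Adj H (p mod ℓ)) (next-mod p) (step (p mod ℓ)) ]
  arc (suc d) p = ≡.subst₂ (λ e x → Walk H cyclic (p mod ℓ) ((suc (suc d) + p) mod ℓ) (segment (suc (suc d)) (suc p)) (e ∷ x))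
      (trans (+-mod p (suc p)) (cong (_mod ℓ) (+-suc p p)))
      (≡.cong₂ _∷_ (trans (+-mod (suc p) (suc p)) (cong (_mod ℓ) (+-suc (suc p) p)))
         (≡.cong₂ segment (≡.sym (+-suc d d)) (cong (λ x → suc (suc x)) (+-suc p p))))
      (subst (Adj H (p mod ℓ)) (next-mod p) (step (p mod ℓ)) ∷
        subst (λ v → Walk H cyclic (suc p mod ℓ) (v mod ℓ) (segment (suc d) (suc (suc p))) (segment (suc (d + d)) (suc (suc p + suc p))))
          (cong suc (+-suc d p)) (arc d (suc p)))

  arc-rainbow : ∀ d p → suc (suc d) ≤ ℓ → suc (d + d) ≤ ℓ → Rainbow H cyclic (allFin ℓ) [] (p mod ℓ) ((suc d + p) mod ℓ)
  arc-rainbow d p le le′ = rainbow (arc d p) (segment-unique (suc (suc d)) p le) (All.tabulate λ _ → ∈-allFin _)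
    (subst Unique (≡.sym (++-identityʳ _)) (segment-unique (suc (d + d)) (suc (p + p)) le′))

  arcs-total : ∀ a d e {b} → suc a + d ≡ b → suc b + e ≡ ℓ → d + suc (suc (a + e)) ≡ ℓ
  arcs-total a d e refl eq = trans (total a d e) eq
    where
    total : ∀ a d e → d + suc (suc (a + e)) ≡ suc (suc a + d) + e
    total = solve-∀

  -- The two arcs between `i` and `j` have `ℓ` edges together, so one of them has at most half of
  -- them and hence fewer than `ℓ` coloured elements.
  ascending : ∀ i j → toℕ i < toℕ j → Rainbow H cyclic (allFin ℓ) [] i j
  ascending i j i<j with m≤n⇒∃[o]m+o≡n i<j | m≤n⇒∃[o]m+o≡n (toℕ<n j)
  ... | d , eqd | e , eqe with arcs-total (toℕ i) d e eqd eqe | suc (d + d) ≤? ℓ | suc ((toℕ i + e) + (toℕ i + e)) ≤? ℓ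
  ...   | _ | yes le | _ = ≡.subst₂ (Rainbow H cyclic (allFin ℓ) []) (mod-toℕ i)
            (trans (cong (_mod ℓ) (trans (cong suc (+-comm d (toℕ i))) eqd)) (mod-toℕ j))
            (arc-rainbow d (toℕ i) (≤-trans (s≤s (≤-trans (s≤s (m≤n+m d (toℕ i))) (≤-reflexive eqd))) (toℕ<n j)) le)
  ...   | sum | no _ | yes le = flip (≡.subst₂ (Rainbow H cyclic (allFin ℓ) []) (mod-toℕ j)
            (trans (mod-cong (suc (toℕ i + e) + toℕ j) (toℕ i)
                     (trans (cong (_% ℓ) (trans (shuffle (toℕ i) e (toℕ j)) (cong (toℕ i +_) eqe))) ([m+n]%n≡m%n (toℕ i) ℓ)))
                   (mod-toℕ i))
            (arc-rainbow (toℕ i + e) (toℕ j) (≤-trans (m≤n+m _ d) (≤-reflexive sum)) le))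
    where
    shuffle : ∀ a e b → suc (a + e) + b ≡ a + (suc b + e)
    shuffle = solve-∀
  ...   | sum | no a | no b = ⊥-elim (m+1+n≰n 3 {d + d + (x + x)} (≤-trans (≤-reflexive (double d x))
      (≤-trans (≤-reflexive (≡.cong₂ _+_ sum sum)) (+-mono-≤ (≤-pred (≰⇒> a)) (≤-pred (≰⇒> b))))))
    where
    x = toℕ i + e
    double : ∀ d x → 3 + suc (d + d + (x + x)) ≡ (d + suc (suc x)) + (d + suc (suc x))
    double = solve-∀
    m+1+n≰n : ∀ m {n} → ¬ (m + suc n ≤ n)
    m+1+n≰n m {n} le = 1+n≰n (≤-trans (m≤n+m (suc n) m) le)

  cyclic-connected : ∀ i j → i ≢ j → Rainbow H cyclic (allFin ℓ) [] i j
  cyclic-connected i j i≢j with <-cmp (toℕ i) (toℕ j)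
  ... | tri< i<j _ _ = ascending i j i<j
  ... | tri≈ _ eq _  = contradiction (toℕ-injective eq) i≢j
  ... | tri> _ _ j<i = flip (ascending j i j<i)

ring-trc : ∀ {m n} {G : Graph n} {h : Fin (suc m) → Fin n} → Connected G → Ring G h → TRConnected G (2 * n ∸ suc m)
ring-trc {m} {n} {G} {h} connected R =
  complete connected (∈-tabulate⁺ {f = h} zero) (Unique.tabulate⁺ inj)
    (Push.push-connected h inj id cyclic cyclic-connected)
    (trans (cong (suc m +_) (≡.sym (+-identityʳ (suc m)))) (cong (2 *_) (≡.sym (length-tabulate h))))
  where
  open Ring R
  open CyclicColouring {H = pullback G h} step

Out : (Fin m → Fin n) → Fin n → Set
Out h x = ∀ i → x ≢ h i

◂-injective : ∀ {x : Fin n} {h : Fin m → Fin n} → Out h x → (∀ {i j} → h i ≡ h j → i ≡ j) →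
              ∀ {i j} → (x ◂ h) i ≡ (x ◂ h) j → i ≡ j
◂-injective out inj {zero}  {zero}  _  = refl
◂-injective out inj {zero}  {suc j} eq = contradiction eq (out j)
◂-injective out inj {suc i} {zero}  eq = contradiction (≡.sym eq) (out i)
◂-injective out inj {suc i} {suc j} eq = cong suc (inj eq)

out⇒∉ : ∀ {h : Fin m → Fin n} {x} → Out h x → x ∉ tabulate h
out⇒∉ {h = h} out x∈ with ∈-tabulate⁻ {f = h} x∈
... | i , eq = out i eq

∉⇒out : ∀ {h : Fin m → Fin n} {x} → x ∉ tabulate h → Out h x
∉⇒out {h = h} x∉ i refl = x∉ (∈-tabulate⁺ {f = h} i)

octagon-trc : ∀ {G : Graph n} {h : Fin 8 → Fin n} → Connected G → Ring G h → TRConnected G (2 * n ∸ 9)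
octagon-trc {h = h} connected R = use-pattern connected octagon 4 9 h inj
  (step 0F ∷ step 1F ∷ step 2F ∷ step 3F ∷ step 4F ∷ step 5F ∷ step 6F ∷ step 7F ∷ []) refl
  where open Ring R

-- Cycle edges and an obstruction to cycles

module _ {n : ℕ} {G : Graph n} where

  pairs-linked : ∀ {Q : Fin n → Fin n → Set} u xs {s v} → End G u xs v →
                 (∀ {a b} → (a , b) ∈ consecPairs G u (xs ++ s ∷ []) → Q a b) → Linked Q (u ∷ xs) × Q v s
  pairs-linked u []       refl q = [-] , q (here refl)
  pairs-linked u (x ∷ xs) e    q with pairs-linked x xs e (q ∘ there)
  ... | l , last = q (here refl) ∷ l , last

  linked-pairs : ∀ {Q : Fin n → Fin n → Set} u xs {s v} → End G u xs v → Linked Q (u ∷ xs) → Q v s →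
                 ∀ {a b} → (a , b) ∈ consecPairs G u (xs ++ s ∷ []) → Q a b
  linked-pairs u []       refl _       q (here refl) = q
  linked-pairs u (x ∷ xs) e    (p ∷ _) q (here refl) = p
  linked-pairs u (x ∷ xs) e    (_ ∷ l) q (there ∈ps) = linked-pairs x xs e l q ∈ps

  cyclePair⇒Adj : (C : Cycle G) → ∀ {a b} → (a , b) ∈ cycleEdges G C → Adj G a b
  cyclePair⇒Adj C = linked-pairs (start C) (others C) (ends C) (linked C) (closes C)

  cycleEdge⇒Adj : (C : Cycle G) → ∀ {a b} → CycleEdge G C a b → Adj G a b
  cycleEdge⇒Adj C (inj₁ e) = cyclePair⇒Adj C e
  cycleEdge⇒Adj C (inj₂ e) = Adj-sym G (cyclePair⇒Adj C e)

  module NoCycle (f : Fin n → ℕ) (f-inj : ∀ {a b} → f a ≡ f b → a ≡ b) where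

    Step : Fin n → Fin n → Set
    Step a b = f b ≡ suc (f a) ⊎ f a ≡ suc (f b)

    -- A rise is never followed by a drop: the walk would regain the value of two steps before, and
    -- by injectivity the same vertex.
    up : ∀ {a b} xs {v} → Linked Step (b ∷ xs) → Unique (a ∷ b ∷ xs) → End G b xs v →
         f b ≡ suc (f a) → f v ≡ suc (length xs) + f a
    up []       _            _ refl b↑ = b↑
    up (c ∷ xs) (inj₁ c↑ ∷ l) (_ ∷ u) e b↑ =
      trans (up xs l u e c↑) (trans (cong (suc (length xs) +_) b↑) (+-suc (suc (length xs)) _))
    up (c ∷ xs) (inj₂ c↓ ∷ l) u e b↑ =
      contradiction (there (here (f-inj (ℕ-suc-injective (trans (≡.sym b↑) c↓))))) (Unique[x∷xs]⇒x∉xs u)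

    down : ∀ {a b} xs {v} → Linked Step (b ∷ xs) → Unique (a ∷ b ∷ xs) → End G b xs v →
           f a ≡ suc (f b) → f a ≡ suc (length xs) + f v
    down []       _            _ refl b↓ = b↓
    down (c ∷ xs) (inj₂ c↓ ∷ l) (_ ∷ u) e b↓ = trans b↓ (cong suc (down xs l u e c↓))
    down (c ∷ xs) (inj₁ c↑ ∷ l) u e b↓ =
      contradiction (there (here (f-inj (trans b↓ (≡.sym c↑))))) (Unique[x∷xs]⇒x∉xs u)

    -- Along a cycle whose edges all change f by one, f is monotone, so the closing edge is too long.
    no-cycle : (C : Cycle G) → (∀ {a b} → (a , b) ∈ cycleEdges G C → Step a b) → ⊥
    no-cycle C steps with pairs-linked (start C) (others C) (ends C) steps
    ... | l , last = go (others C) (long C) l (unique C) (ends C) last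
      where
      far : ∀ x y k → y ≡ suc (suc k) + x → ¬ (y ≡ suc x ⊎ x ≡ suc y)
      far x _ k refl (inj₁ eq) = m≢1+n+m x (≡.sym (ℕ-suc-injective eq))
      far x _ k refl (inj₂ eq) = m≢1+n+m x eq
      go : ∀ {s v} xs → 2 ≤ length xs → Linked Step (s ∷ xs) → Unique (s ∷ xs) → End G s xs v → Step v s → ⊥
      go (x ∷ [])     (s≤s ()) _ _ _ _
      go (x ∷ y ∷ xs) _ (inj₁ x↑ ∷ l) u e (inj₁ last) = far _ _ (length xs) (up (y ∷ xs) l u e x↑) (inj₂ last)
      go (x ∷ y ∷ xs) _ (inj₁ x↑ ∷ l) u e (inj₂ last) = far _ _ (length xs) (up (y ∷ xs) l u e x↑) (inj₁ last)
      go (x ∷ y ∷ xs) _ (inj₂ x↓ ∷ l) u e last        = far _ _ (length xs) (down (y ∷ xs) l u e x↓) last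

-- Circumference seven

abstract

  rotate-surjective₇ : ∀ (i j : Fin 7) → ∃ λ d → rotate i d ≡ j
  rotate-surjective₇ = from-yes (all? λ (i : Fin 7) → all? λ (j : Fin 7) → any? λ d → rotate i d ≟ j)

  rotate-4-3 : ∀ (i : Fin 7) → rotate (rotate i 4F) 3F ≡ i
  rotate-4-3 = from-yes (all? λ (i : Fin 7) → rotate (rotate i 4F) 3F ≟ i)

  rotate-5-2 : ∀ (i : Fin 7) → rotate (rotate i 5F) 2F ≡ i
  rotate-5-2 = from-yes (all? λ (i : Fin 7) → rotate (rotate i 5F) 2F ≟ i)

  next-rotate-6 : ∀ (i : Fin 7) → next (rotate i 6F) ≡ i
  next-rotate-6 = from-yes (all? λ (i : Fin 7) → next (rotate i 6F) ≟ i)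

  rotate-next-6 : ∀ (i : Fin 7) → rotate (next i) 6F ≡ i
  rotate-next-6 = from-yes (all? λ (i : Fin 7) → rotate (next i) 6F ≟ i)

  rotate-1 : ∀ (i : Fin 7) → rotate i 1F ≡ next i
  rotate-1 = from-yes (all? λ (i : Fin 7) → rotate i 1F ≟ next i)

module CriticalHeptagon {n : ℕ} {G : Graph n} (connected : Connected G) (critical : ¬ TRConnected G (2 * n ∸ 9)) where

  module Heptagon {h : Fin 7 → Fin n} (R : Ring G h) where
    open Ring R

    no-tail₀ : ∀ {x} → Out h x → ¬ Adj G x (h 0F)
    no-tail₀ {x} out a = critical (use-pattern connected heptagon-tail 4 9 (x ◂ h) (◂-injective out inj)
      (step 0F ∷ step 1F ∷ step 2F ∷ step 3F ∷ step 4F ∷ step 5F ∷ step 6F ∷ a ∷ []) refl)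

    no-chord₀₂ : ¬ Adj G (h 0F) (h 2F)
    no-chord₀₂ a = critical (use-pattern connected heptagon-chord₂ 3 9 h inj
      (step 0F ∷ step 1F ∷ step 2F ∷ step 3F ∷ step 4F ∷ step 5F ∷ step 6F ∷ a ∷ []) refl)

    no-chord₀₃ : ¬ Adj G (h 0F) (h 3F)
    no-chord₀₃ a = critical (use-pattern connected heptagon-chord₃ 3 9 h inj
      (step 0F ∷ step 1F ∷ step 2F ∷ step 3F ∷ step 4F ∷ step 5F ∷ step 6F ∷ a ∷ []) refl)

  module _ {h : Fin 7 → Fin n} (R : Ring G h) where
    open Ring R
    open Heptagon

    -- Otherwise connectedness gives an edge from outside to some vertex of the ring, and a rotation
    -- makes it a forbidden tail at position 0.
    heptagon-spans : ∀ v → v ∈ tabulate h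
    heptagon-spans v with full? {G = G} (tabulate h)
    ... | inj₁ full = full v
    ... | inj₂ (x , x∉) with frontier connected (∈-tabulate⁺ {f = h} zero) x∉
    ...   | z , w , z∉ , w∈ , zw with ∈-tabulate⁻ {f = h} w∈
    ...     | i , refl = ⊥-elim (no-tail₀ (ring-rotate i R) (λ j → ∉⇒out {h = h} z∉ (rotate i j))
                           (subst (Adj G z ∘ h) (≡.sym (rotate-zero i)) zw))

    abstract

      -- Chords spanning 4 or 5 steps span 3 or 2 when read from their other end, so two forbidden
      -- chords cover all cases.
      heptagon-edge : ∀ i j → Adj G (h i) (h j) → j ≡ next i ⊎ i ≡ next j
      heptagon-edge i j a with rotate-surjective₇ i j
      ... | 0F , refl = contradiction (cong h (≡.sym (rotate-zero i))) (Adj⇒≢ G a)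
      ... | 1F , refl = inj₁ (rotate-1 i)
      ... | 2F , refl = ⊥-elim (no-chord₀₂ (ring-rotate i R) (subst (λ x → Adj G (h x) (h (rotate i 2F))) (≡.sym (rotate-zero i)) a))
      ... | 3F , refl = ⊥-elim (no-chord₀₃ (ring-rotate i R) (subst (λ x → Adj G (h x) (h (rotate i 3F))) (≡.sym (rotate-zero i)) a))
      ... | 4F , refl = ⊥-elim (no-chord₀₃ (ring-rotate (rotate i 4F) R)
                          (≡.subst₂ (λ x y → Adj G (h x) (h y)) (≡.sym (rotate-zero (rotate i 4F))) (≡.sym (rotate-4-3 i)) (Adj-sym G a)))
      ... | 5F , refl = ⊥-elim (no-chord₀₂ (ring-rotate (rotate i 5F) R)
                          (≡.subst₂ (λ x y → Adj G (h x) (h y)) (≡.sym (rotate-zero (rotate i 5F))) (≡.sym (rotate-5-2 i)) (Adj-sym G a)))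
      ... | 6F , refl = inj₂ (≡.sym (next-rotate-6 i))

  module _ {h : Fin 7 → Fin n} (R : Ring G h) where
    open Ring R

    h-preimage : ∀ v → h (preimage h v) ≡ v
    h-preimage v with ∈-tabulate⁻ {f = h} (heptagon-spans R v)
    ... | i , refl = cong h (preimage-f h inj i)

    -- Positions along the path obtained by deleting the edge between h 6 and h 0.
    position : Fin n → ℕ
    position = toℕ ∘ preimage h

    position-injective : ∀ {a b} → position a ≡ position b → a ≡ b
    position-injective {a} {b} eq = trans (≡.sym (h-preimage a)) (trans (cong h (toℕ-injective eq)) (h-preimage b))

    next-position : ∀ i → i ≢ 6F → toℕ (next {6} i) ≡ suc (toℕ i)
    next-position 0F _ = refl
    next-position 1F _ = refl
    next-position 2F _ = refl
    next-position 3F _ = refl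
    next-position 4F _ = refl
    next-position 5F _ = refl
    next-position 6F ne = contradiction refl ne

    open NoCycle {G = G} position position-injective

    -- A cycle avoiding this edge would change `position` by exactly one along each of its edges.
    closing-edge : (C : Cycle G) → ¬ ¬ CycleEdge G C (h 6F) (h 0F)
    closing-edge C missing = no-cycle C λ {a} {b} ab → subst₂′ a b (step′ a b ab)
      where
      subst₂′ : ∀ a b → Step (h (preimage h a)) (h (preimage h b)) → Step a b
      subst₂′ a b = ≡.subst₂ Step (h-preimage a) (h-preimage b)
      step′ : ∀ a b → (a , b) ∈ cycleEdges G C → Step (h (preimage h a)) (h (preimage h b))
      step′ a b ab = go (preimage h a) (preimage h b) (≡.subst₂ (λ x y → (x , y) ∈ cycleEdges G C) (≡.sym (h-preimage a)) (≡.sym (h-preimage b)) ab)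
        where
        pos : ∀ i → position (h i) ≡ toℕ i
        pos i = cong toℕ (preimage-f h inj i)
        go : ∀ i j → (h i , h j) ∈ cycleEdges G C → Step (h i) (h j)
        go i j ij with heptagon-edge R i j (cyclePair⇒Adj C ij)
        ... | inj₁ refl = inj₁ (trans (pos (next i)) (trans (next-position i (λ { refl → missing (inj₁ ij) })) (cong suc (≡.sym (pos i)))))
        ... | inj₂ refl = inj₂ (trans (pos (next j)) (trans (next-position j (λ { refl → missing (inj₂ ij) })) (cong suc (≡.sym (pos j)))))

  -- The edge of the first cycle that the second one lacks lies on the ring. Rotating it into the
  -- closing position shows that the second cycle has it after all.
  heptagon-impossible : AtLeastTwoCycles G → ∀ {h : Fin 7 → Fin n} → ¬ Ring G h
  heptagon-impossible (C₁ , C₂ , u , v , in₁ , ∉₂) {h} R with ∈-tabulate⁻ {f = h} (heptagon-spans R u) | ∈-tabulate⁻ {f = h} (heptagon-spans R v)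
  ... | i , refl | j , refl with heptagon-edge R i j (cycleEdge⇒Adj C₁ in₁)
  ...   | inj₁ refl = closing-edge (ring-rotate (next i) R) C₂ (∉₂ ∘ ≡.subst₂ (λ x y → CycleEdge G C₂ (h x) (h y))
                        (rotate-next-6 i) (rotate-zero (next i)))
  ...   | inj₂ refl = closing-edge (ring-rotate (next j) R) C₂ (∉₂ ∘ Sum.swap ∘ ≡.subst₂ (λ x y → CycleEdge G C₂ (h x) (h y))
                        (rotate-next-6 j) (rotate-zero (next j)))

-- Circumference six

-- The reserved colours `5F` and `6F` sit on the two edges at position 3, opposite the fork, so the
-- walk from there to 0 can take the side that avoids a given one. From every other position the
-- walk reaches 0 without passing 3.
hexagon-fork : Pattern 6 6
hexagon-fork = record
  { vs = 0F ∷ 2F ∷ 4F ∷ 0F ∷ 1F ∷ 2F ∷ []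
  ; es = (0F , 1F , 1F) ∷ (1F , 2F , 3F) ∷ (2F , 3F , 6F) ∷ (3F , 4F , 5F) ∷
         (4F , 5F , 3F) ∷ (5F , 0F , 4F) ∷ [] }

hexagon-fork-connected : ∀ i j → Reaches hexagon-fork 3 [] i j
hexagon-fork-connected = from-yes (connected? hexagon-fork 3)

hexagon-fork-α : ∀ i → Reaches hexagon-fork 3 (0F ∷ 5F ∷ []) i 0F
hexagon-fork-α = from-yes (all? λ i → reaches? hexagon-fork 3 (0F ∷ 5F ∷ []) i 0F)

hexagon-fork-β : ∀ i → Reaches hexagon-fork 3 (0F ∷ 6F ∷ []) i 0F
hexagon-fork-β = from-yes (all? λ i → reaches? hexagon-fork 3 (0F ∷ 6F ∷ []) i 0F)

reflect : Fin 6 → Fin 6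
reflect = Vec.lookup (0F ∷ 5F ∷ 4F ∷ 3F ∷ 2F ∷ 1F ∷ [])

reflect-involutive : ∀ i → reflect (reflect i) ≡ i
reflect-involutive = from-yes (all? λ i → reflect (reflect i) ≟ i)

-- `height` and `depth` are the distances from positions 3 and 0 in the chordless hexagon; they add
-- up to 3.
height : Fin 6 → ℕ
height = Vec.lookup (3 ∷ 2 ∷ 1 ∷ 0 ∷ 1 ∷ 2 ∷ [])

depth : Fin 6 → ℕ
depth = Vec.lookup (0 ∷ 1 ∷ 2 ∷ 3 ∷ 2 ∷ 1 ∷ [])

module _ {n : ℕ} (G : Graph n) where

  Lipschitz : List (Fin n) → (Fin n → ℕ) → Set
  Lipschitz S f = ∀ {u v} → u ∈ S → v ∈ S → Adj G u v → f u ≤ suc (f v)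

  module _ (h : Fin 6 → Fin n) where

    Short₀ Short₁ Short : Set
    -- The chords of each pair are exchanged by the half turn, and rotating by one step carries this
    -- pair to that of `Short₁`.
    Short₀ = Adj G (h 0F) (h 2F) ⊎ Adj G (h 3F) (h 5F)
    Short₁ = Adj G (h 1F) (h 3F) ⊎ Adj G (h 4F) (h 0F)
    -- h 0 and h 3 are at distance at most two
    Short  = Adj G (h 0F) (h 3F) ⊎ Short₀ ⊎ Short₁

    short? : Dec Short
    short? = adj? 0F 3F ⊎-dec (adj? 0F 2F ⊎-dec adj? 3F 5F) ⊎-dec (adj? 1F 3F ⊎-dec adj? 4F 0F)
      where
      adj? : ∀ i j → Dec (Adj G (h i) (h j))
      adj? i j = adj G (h i) (h j) Bool.≟ true

module _ {n : ℕ} {G : Graph n} where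

  hexagon-forkable : ∀ {h : Fin 6 → Fin n} → Ring G h → Forkable G 7 (tabulate h) (h 0F)
  hexagon-forkable {h} R = record
    { c = pushed ; α = 5F ; β = 6F ; α≢β = λ () ; r≢α = λ e → 0≢5 (trans (≡.sym r-col) e) ; r≢β = λ e → 0≢6 (trans (≡.sym r-col) e)
    ; conn = push-connected (λ i j → reaches⇒rainbow hexagon-fork {3} (hexagon-fork-connected i j))
    ; toα = to 5F hexagon-fork-α ; toβ = to 6F hexagon-fork-β }
    where
    open Ring R
    open Push h {patternGraph hexagon-fork} {G} inj
      (pattern-hom hexagon-fork {G = G} {f = h} (step 0F ∷ step 1F ∷ step 2F ∷ step 3F ∷ step 4F ∷ step 5F ∷ []))
      (patternColoring hexagon-fork)
    r-col : vcol pushed (h 0F) ≡ 0F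
    r-col = vcol-pushed 0F
    0≢5 : _≢_ {A = Fin 7} 0F 5F
    0≢5 ()
    0≢6 : _≢_ {A = Fin 7} 0F 6F
    0≢6 ()
    to : ∀ δ → (∀ i → Reaches hexagon-fork 3 (0F ∷ δ ∷ []) i 0F) →
         ∀ {y} → y ∈ tabulate h → y ≢ h 0F → Rainbow G pushed (tabulate h) (vcol pushed (h 0F) ∷ δ ∷ []) y (h 0F)
    to δ reach y∈ y≢ with ∈-tabulate⁻ {f = h} y∈
    ... | i , refl = subst (λ e → Rainbow G pushed (tabulate h) (e ∷ δ ∷ []) (h i) (h 0F)) (≡.sym r-col)
                       (push (reaches⇒rainbow hexagon-fork {3} (reach i) (y≢ ∘ cong h)))

  ring-reflect : ∀ {h : Fin 6 → Fin n} → Ring G h → Ring G (h ∘ reflect)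
  ring-reflect R = record
    { inj  = λ {i} {j} eq → trans (≡.sym (reflect-involutive i)) (trans (cong reflect (inj eq)) (reflect-involutive j))
    ; step = λ { 0F → Adj-sym G (step 5F) ; 1F → Adj-sym G (step 4F) ; 2F → Adj-sym G (step 3F)
               ; 3F → Adj-sym G (step 2F) ; 4F → Adj-sym G (step 1F) ; 5F → Adj-sym G (step 0F) } }
    where open Ring R

  module _ {h : Fin 6 → Fin n} (inj : ∀ {i j} → h i ≡ h j → i ≡ j) (long : ¬ Short G h) where

    private
      -- The listed pairs are exactly those on which `height` drops by more than one, and their
      -- chords are the ones in `Short`.
      steep : ∀ i j → height i ≤ suc (height j) × depth j ≤ suc (depth i) ⊎
                (i ≡ 0F × j ≡ 3F) ⊎ ((i ≡ 0F × j ≡ 2F) ⊎ (i ≡ 5F × j ≡ 3F)) ⊎ ((i ≡ 1F × j ≡ 3F) ⊎ (i ≡ 0F × j ≡ 4F))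
      steep = from-yes (all? λ i → all? λ j → (height i ≤? suc (height j) ×-dec depth j ≤? suc (depth i)) ⊎-dec
                (i ≟ 0F ×-dec j ≟ 3F) ⊎-dec
                ((i ≟ 0F ×-dec j ≟ 2F) ⊎-dec (i ≟ 5F ×-dec j ≟ 3F)) ⊎-dec ((i ≟ 1F ×-dec j ≟ 3F) ⊎-dec (i ≟ 0F ×-dec j ≟ 4F)))

      gentle : ∀ i j → Adj G (h i) (h j) → height i ≤ suc (height j) × depth j ≤ suc (depth i)
      gentle i j a with steep i j
      ... | inj₁ ok = ok
      ... | inj₂ (inj₁ (refl , refl)) = ⊥-elim (long (inj₁ a))
      ... | inj₂ (inj₂ (inj₁ (inj₁ (refl , refl)))) = ⊥-elim (long (inj₂ (inj₁ (inj₁ a))))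
      ... | inj₂ (inj₂ (inj₁ (inj₂ (refl , refl)))) = ⊥-elim (long (inj₂ (inj₁ (inj₂ (Adj-sym G a)))))
      ... | inj₂ (inj₂ (inj₂ (inj₁ (refl , refl)))) = ⊥-elim (long (inj₂ (inj₂ (inj₁ a))))
      ... | inj₂ (inj₂ (inj₂ (inj₂ (refl , refl)))) = ⊥-elim (long (inj₂ (inj₂ (inj₂ (Adj-sym G a)))))

      lip : ∀ (f : Fin 6 → ℕ) → (∀ i j → Adj G (h i) (h j) → f i ≤ suc (f j)) → Lipschitz G (tabulate h) (f ∘ preimage h)
      lip f le u∈ v∈ a with ∈-tabulate⁻ {f = h} u∈ | ∈-tabulate⁻ {f = h} v∈
      ... | i , refl | j , refl = ≡.subst₂ (λ x y → f x ≤ suc (f y)) (≡.sym (preimage-f h inj i)) (≡.sym (preimage-f h inj j)) (le i j a)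

    height-lipschitz : Lipschitz G (tabulate h) (height ∘ preimage h)
    height-lipschitz = lip height λ i j a → proj₁ (gentle i j a)

    depth-lipschitz : Lipschitz G (tabulate h) (depth ∘ preimage h)
    depth-lipschitz = lip depth λ i j a → proj₂ (gentle j i (Adj-sym G a))

module _ {n : ℕ} {G : Graph n} where

  lipschitz-path : ∀ {f : Fin n → ℕ} → (∀ {a b} → Adj G a b → f a ≤ suc (f b)) →
                   ∀ {u v} xs → Linked (Adj G) (u ∷ xs) → End G u xs v → f u ≤ length xs + f v
  lipschitz-path lip []       _       refl = ≤-refl
  lipschitz-path lip (x ∷ xs) (a ∷ l) e    = ≤-trans (lip a) (s≤s (lipschitz-path lip xs l e))

  -- The gap condition says that `f` drops by at least n - 3 from `u` to `v`, and each edge of a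
  -- path accounts for at most one.
  lipschitz⇒diam≥ : ∀ {f : Fin n → ℕ} {u v D} → (∀ {a b} → Adj G a b → f a ≤ suc (f b)) →
                    f v + n ≤ 3 + f u → Diam G D → n ≤ 3 + D
  lipschitz⇒diam≥ {f} {u} {v} {D} lip gap (dist , _) with dist u v
  ... | d , ((P , refl) , _) , d≤D = +-cancelˡ-≤ (f v) n (3 + D) (≤-trans gap (≤-trans
      (+-monoʳ-≤ 3 (≤-trans (lipschitz-path lip (rest P) (linked P) (ends P)) (+-monoˡ-≤ (f v) d≤D))) (≤-reflexive (+-comm (3 + D) (f v)))))

-- A dummy colouring, which lets `Walk` and `reverse` serve for walks whose colours are of no
-- interest.
monochrome : (G : Graph n) → TotalColoring G 1
monochrome G = record { vcol = λ _ → 0F ; ecol = λ _ _ → 0F ; ecolSym = λ _ _ → refl }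

-- Forbidden configurations around a hexagon

module CriticalHexagon {n : ℕ} {G : Graph n} (connected : Connected G) (critical : ¬ TRConnected G (2 * n ∸ 9))
                       (short-cycles : ∀ (C : Cycle G) → cycleLength G C ≤ 6) where

  module _ {h : Fin 6 → Fin n} (R : Ring G h) where
    open Ring R

    module _ {x} (out : Out h x) (x0 : Adj G x (h 0F)) where

      no-ear₁ : ¬ Adj G x (h 1F)
      no-ear₁ a = critical (use-pattern connected hexagon-ear₁ 3 9 (x ◂ h) (◂-injective out inj)
        (step 0F ∷ step 1F ∷ step 2F ∷ step 3F ∷ step 4F ∷ step 5F ∷ x0 ∷ a ∷ []) refl)

      no-ear₂ : ¬ Adj G x (h 2F)
      no-ear₂ a = critical (use-pattern connected hexagon-ear₂ 3 9 (x ◂ h) (◂-injective out inj)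
        (step 0F ∷ step 1F ∷ step 2F ∷ step 3F ∷ step 4F ∷ step 5F ∷ x0 ∷ a ∷ []) refl)

      no-ear₃ : ¬ Adj G x (h 3F)
      no-ear₃ a = critical (use-pattern connected hexagon-ear₃ 3 9 (x ◂ h) (◂-injective out inj)
        (step 0F ∷ step 1F ∷ step 2F ∷ step 3F ∷ step 4F ∷ step 5F ∷ x0 ∷ a ∷ []) refl)

      no-chord₀₃ : ¬ Adj G (h 0F) (h 3F)
      no-chord₀₃ a = critical (use-pattern connected hexagon-03-tail 3 9 (x ◂ h) (◂-injective out inj)
        (step 0F ∷ step 1F ∷ step 2F ∷ step 3F ∷ step 4F ∷ step 5F ∷ x0 ∷ a ∷ []) refl)

      no-chord₀₂ : ¬ Adj G (h 0F) (h 2F)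
      no-chord₀₂ a = critical (use-pattern connected hexagon-02-tail 3 9 (x ◂ h) (◂-injective out inj)
        (step 0F ∷ step 1F ∷ step 2F ∷ step 3F ∷ step 4F ∷ step 5F ∷ x0 ∷ a ∷ []) refl)

      no-chord₁₃ : ¬ Adj G (h 1F) (h 3F)
      no-chord₁₃ a = critical (use-pattern connected hexagon-13-tail 3 9 (x ◂ h) (◂-injective out inj)
        (step 0F ∷ step 1F ∷ step 2F ∷ step 3F ∷ step 4F ∷ step 5F ∷ x0 ∷ a ∷ []) refl)

      module _ {y} (outy : Out h y) (y≢x : y ≢ x) where

        private
          outy′ : Out (x ◂ h) y
          outy′ zero    = y≢x
          outy′ (suc i) = outy i

        no-tails₁ : ¬ Adj G y (h 1F)
        no-tails₁ a = critical (use-pattern connected hexagon-tails₁ 4 9 (y ◂ (x ◂ h)) (◂-injective outy′ (◂-injective out inj))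
          (step 0F ∷ step 1F ∷ step 2F ∷ step 3F ∷ step 4F ∷ step 5F ∷ x0 ∷ a ∷ []) refl)

        no-tails₂ : ¬ Adj G y (h 2F)
        no-tails₂ a = critical (use-pattern connected hexagon-tails₂ 4 9 (y ◂ (x ◂ h)) (◂-injective outy′ (◂-injective out inj))
          (step 0F ∷ step 1F ∷ step 2F ∷ step 3F ∷ step 4F ∷ step 5F ∷ x0 ∷ a ∷ []) refl)

        no-long-ear : Adj G y (h 3F) → ¬ Adj G x y
        no-long-ear a b = critical (use-pattern connected hexagon-long-ear 4 9 (y ◂ (x ◂ h)) (◂-injective outy′ (◂-injective out inj))
          (step 0F ∷ step 1F ∷ step 2F ∷ step 3F ∷ step 4F ∷ step 5F ∷ x0 ∷ a ∷ b ∷ []) refl)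

        -- A branching tail of length zero: the fork puts 7 colours on 8 vertices.
        no-tails₀ : ¬ Adj G y (h 0F)
        no-tails₀ y0 with fork (∈-tabulate⁺ {f = h} 0F) (out⇒∉ out) (out⇒∉ outy) (y≢x ∘ ≡.sym) x0 y0 (hexagon-forkable R)
        ... | c , conn = critical (complete connected {a = 9} (here refl)
                (((λ { (here e) → y≢x (≡.sym e) ; (there e) → out⇒∉ {h = h} out e })) ∷ᵘ out⇒∉ outy ∷ᵘ Unique.tabulate⁺ inj) conn refl)

    no-02-13 : Adj G (h 0F) (h 2F) → ¬ Adj G (h 1F) (h 3F)
    no-02-13 a b = critical (use-pattern connected hexagon-02-13 2 9 h inj
      (step 0F ∷ step 1F ∷ step 2F ∷ step 3F ∷ step 4F ∷ step 5F ∷ a ∷ b ∷ []) refl)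

    no-02-04 : Adj G (h 0F) (h 2F) → ¬ Adj G (h 0F) (h 4F)
    no-02-04 a b = critical (use-pattern connected hexagon-02-04 2 9 h inj
      (step 0F ∷ step 1F ∷ step 2F ∷ step 3F ∷ step 4F ∷ step 5F ∷ a ∷ b ∷ []) refl)

    no-02-14 : Adj G (h 0F) (h 2F) → ¬ Adj G (h 1F) (h 4F)
    no-02-14 a b = critical (use-pattern connected hexagon-02-14 2 9 h inj
      (step 0F ∷ step 1F ∷ step 2F ∷ step 3F ∷ step 4F ∷ step 5F ∷ a ∷ b ∷ []) refl)

    no-03-14-25 : Adj G (h 0F) (h 3F) → Adj G (h 1F) (h 4F) → ¬ Adj G (h 2F) (h 5F)
    no-03-14-25 a b c = critical (use-pattern connected hexagon-03-14-25 2 9 h inj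
      (step 0F ∷ step 1F ∷ step 2F ∷ step 3F ∷ step 4F ∷ step 5F ∷ a ∷ b ∷ c ∷ []) refl)

  module _ {h : Fin 6 → Fin n} (R : Ring G h) where

    -- Up to a half turn the two chords are 02 with 13 or 02 with 04, and either pair gives diameter
    -- two.
    not-both-short : Short₀ G h → ¬ Short₁ G h
    not-both-short (inj₁ a) (inj₁ b) = no-02-13 R a b
    not-both-short (inj₁ a) (inj₂ b) = no-02-04 R a (Adj-sym G b)
    not-both-short (inj₂ a) (inj₁ b) = no-02-04 (ring-rotate 3F R) a (Adj-sym G b)
    not-both-short (inj₂ a) (inj₂ b) = no-02-13 (ring-rotate 3F R) a b

    short-excludes-14 : Short₀ G h → ¬ Adj G (h 1F) (h 4F)
    short-excludes-14 (inj₁ a) b = no-02-14 R a b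
    short-excludes-14 (inj₂ a) b = no-02-14 (ring-rotate 3F R) a (Adj-sym G b)

  module _ {h : Fin 6 → Fin n} (R : Ring G h) where

    private
      R₁ = ring-rotate 1F R
      R₂ = ring-rotate 2F R

    -- Short₀ of R₁ and R₂ are Short₁ of R and R₁, and Short₁ of R₂ is Short₀ of R with its sides swapped.
    not-all-short : Short G h → Short G (h ∘ rotate 1F) → ¬ Short G (h ∘ rotate 2F)
    not-all-short (inj₁ l₀)        (inj₁ l₁)        (inj₁ l₂)        = no-03-14-25 R l₀ l₁ l₂
    not-all-short (inj₁ l₀)        _                (inj₂ (inj₁ c))  = short-excludes-14 R₂ c (Adj-sym G l₀)
    not-all-short (inj₁ l₀)        (inj₂ (inj₂ c))  _                = short-excludes-14 R₂ c (Adj-sym G l₀)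
    not-all-short (inj₁ l₀)        (inj₁ l₁)        (inj₂ (inj₂ a))  = short-excludes-14 R (Sum.swap a) l₁
    not-all-short (inj₁ l₀)        (inj₂ (inj₁ b))  (inj₁ l₂)        = short-excludes-14 R₁ b l₂
    not-all-short (inj₁ l₀)        (inj₂ (inj₁ b))  (inj₂ (inj₂ a))  = not-both-short R (Sum.swap a) b
    not-all-short (inj₂ (inj₁ a))  (inj₁ l₁)        _                = short-excludes-14 R a l₁
    not-all-short (inj₂ (inj₁ a))  (inj₂ (inj₁ b))  _                = not-both-short R a b
    not-all-short (inj₂ (inj₁ a))  (inj₂ (inj₂ c))  _                = not-both-short R₂ c (Sum.swap a)
    not-all-short (inj₂ (inj₂ b))  _                (inj₁ l₂)        = short-excludes-14 R₁ b l₂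
    not-all-short (inj₂ (inj₂ b))  _                (inj₂ (inj₁ c))  = not-both-short R₁ b c
    not-all-short (inj₂ (inj₂ b))  _                (inj₂ (inj₂ a))  = not-both-short R (Sum.swap a) b

    module _ {x} (out : Out h x) (x0 : Adj G x (h 0F)) where

      -- The reflection in the axis through positions 0 and 3 keeps the tail and exchanges the chord
      -- 35 with 13 and 04 with 02.
      tail⇒long : ¬ Short G h
      tail⇒long (inj₁ a)               = no-chord₀₃ R out x0 a
      tail⇒long (inj₂ (inj₁ (inj₁ a))) = no-chord₀₂ R out x0 a
      tail⇒long (inj₂ (inj₁ (inj₂ a))) = no-chord₁₃ (ring-reflect R) (out ∘ reflect) x0 (Adj-sym G a)
      tail⇒long (inj₂ (inj₂ (inj₁ a))) = no-chord₁₃ R out x0 a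
      tail⇒long (inj₂ (inj₂ (inj₂ a))) = no-chord₀₂ (ring-reflect R) (out ∘ reflect) x0 (Adj-sym G a)

      -- An edge to position 4 or 5 is read from that end: after the rotation the original tail is
      -- the ear at distance 2 or 1.
      tail-only : ∀ j → Adj G x (h j) → j ≡ 0F
      tail-only 0F _ = refl
      tail-only 1F a = ⊥-elim (no-ear₁ R out x0 a)
      tail-only 2F a = ⊥-elim (no-ear₂ R out x0 a)
      tail-only 3F a = ⊥-elim (no-ear₃ R out x0 a)
      tail-only 4F a = ⊥-elim (no-ear₂ (ring-rotate 4F R) (out ∘ rotate 4F) a x0)
      tail-only 5F a = ⊥-elim (no-ear₁ (ring-rotate 5F R) (out ∘ rotate 5F) a x0)

      other-tail : ∀ {y} → Out h y → y ≢ x → ∀ j → Adj G y (h j) → j ≡ 3F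
      other-tail outy y≢x 0F a = ⊥-elim (no-tails₀ R out x0 outy y≢x a)
      other-tail outy y≢x 1F a = ⊥-elim (no-tails₁ R out x0 outy y≢x a)
      other-tail outy y≢x 2F a = ⊥-elim (no-tails₂ R out x0 outy y≢x a)
      other-tail outy y≢x 3F a = refl
      other-tail outy y≢x 4F a = ⊥-elim (no-tails₂ (ring-rotate 4F R) (outy ∘ rotate 4F) a (out ∘ rotate 4F) (y≢x ∘ ≡.sym) x0)
      other-tail outy y≢x 5F a = ⊥-elim (no-tails₁ (ring-rotate 5F R) (outy ∘ rotate 5F) a (out ∘ rotate 5F) (y≢x ∘ ≡.sym) x0)

  -- Growing tails at opposite vertices

  -- A hexagon with tails ending at r₁ and r₂, attached at opposite vertices; all edges
  -- leaving S start at r₁ or r₂.  The functions f and g grow by |S| − 3 from one end to the other.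
  record TwoTails (S : List (Fin n)) (r₁ r₂ : Fin n) : Set where
    field
      uniq   : Unique S
      r₁∈    : r₁ ∈ S
      r₂∈    : r₂ ∈ S
      r₁≢r₂  : r₁ ≢ r₂
      {κ}    : ℕ
      size   : κ + 5 ≡ 2 * length S
      fork₁  : Forkable G κ S r₁
      fork₂  : Forkable G κ S r₂
      f g    : Fin n → ℕ
      f-lip  : Lipschitz G S f
      g-lip  : Lipschitz G S g
      f-gap  : f r₂ + length S ≡ 3 + f r₁
      g-gap  : g r₁ + length S ≡ 3 + g r₂
      closed : ∀ {z u} → z ∉ S → u ∈ S → Adj G z u → u ≡ r₁ ⊎ u ≡ r₂
      ear₁   : ∀ {z} → z ∉ S → Adj G z r₁ → ¬ Adj G z r₂
      ear₂   : ∀ {x y} → x ∉ S → y ∉ S → x ≢ y → Adj G x r₁ → Adj G y r₂ → ¬ Adj G x y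
      {spine}  : List (Fin n)
      {colors} : List (Fin 1)
      spine-walk   : Walk G (monochrome G) r₁ r₂ spine colors
      spine-unique : Unique (r₁ ∷ spine)
      spine-inside : All (_∈ S) (r₁ ∷ spine)
      spine-long   : 3 ≤ length spine

  -- Each end has its own fork and its own function, so growth has to be described at one end only.
  swap-tails : ∀ {S r₁ r₂} → TwoTails S r₁ r₂ → TwoTails S r₂ r₁
  swap-tails {S} {r₁} {r₂} T with reverse (TwoTails.spine-walk T)
  ... | ys , ds , q , perm , _ = record
    { uniq = uniq ; r₁∈ = r₂∈ ; r₂∈ = r₁∈ ; r₁≢r₂ = r₁≢r₂ ∘ ≡.sym ; size = size ; fork₁ = fork₂ ; fork₂ = fork₁
    ; f = g ; g = f ; f-lip = g-lip ; g-lip = f-lip ; f-gap = g-gap ; g-gap = f-gap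
    ; closed = λ z∉ u∈ a → Sum.swap (closed z∉ u∈ a)
    ; ear₁ = λ z∉ a b → ear₁ z∉ b a
    ; ear₂ = λ x∉ y∉ x≢y a b c → ear₂ y∉ x∉ (x≢y ∘ ≡.sym) b a (Adj-sym G c)
    ; spine-walk = q ; spine-unique = unique-↭ (↭-sym perm) spine-unique
    ; spine-inside = All-resp-↭ (↭-sym perm) spine-inside
    ; spine-long = ≤-pred (subst (4 ≤_) (↭-length (↭-sym perm)) (s≤s spine-long)) }
    where
    open TwoTails T

  grow : ∀ {S r₁ r₂ z} → TwoTails S r₁ r₂ → z ∉ S → Adj G z r₁ → TwoTails (z ∷ S) z r₂
  grow {S} {r₁} {r₂} {z} T z∉ zr₁ = record
    { uniq = z∉ ∷ᵘ uniq ; r₁∈ = here refl ; r₂∈ = there r₂∈ ; r₁≢r₂ = ∈⇒≢ z∉ r₂∈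
    ; size = trans (cong (2 +_) size) (≡.sym (*-suc 2 (length S)))
    ; fork₁ = fork-grow-tip r₁∈ z∉ zr₁ fork₁ ; fork₂ = fork-grow-elsewhere r₂∈ r₁∈ z∉ zr₁ r₁≢r₂ fork₂
    ; f = f′ ; g = g′ ; f-lip = f-lip′ ; g-lip = g-lip′
    ; f-gap = trans (cong (_+ suc (length S)) (f-old r₂∈)) (trans (+-suc (f r₂) (length S)) (trans (cong suc f-gap) (cong (3 +_) (≡.sym f-new))))
    ; g-gap = trans (cong (_+ suc (length S)) g-new) (trans (+-suc (g r₁) (length S)) (trans (cong suc g-gap) (cong (3 +_) (≡.sym (g-old r₂∈)))))
    ; closed = closed′
    -- A vertex joined to both new ends would form, together with `z`, a two-vertex ear between the
    -- old ends.
    ; ear₁ = λ y∉ yz yr₂ → ear₂ z∉ (y∉ ∘ there) (λ { refl → y∉ (here refl) }) zr₁ yr₂ (Adj-sym G yz)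
    ; ear₂ = ear₂′
    ; spine-walk = zr₁ ∷ spine-walk
    ; spine-unique = (λ z∈ → z∉ (All.lookup spine-inside z∈)) ∷ᵘ spine-unique
    ; spine-inside = here refl ∷ All.map there spine-inside
    ; spine-long = m≤n⇒m≤1+n spine-long }
    where
    open TwoTails T
    f′ g′ : Fin n → ℕ
    f′ v = if does (v ≟ z) then suc (f r₁) else f v
    -- `g` may already be 0 at `r₁`, as `depth` is at the start; so the old values are raised
    -- instead of giving `z` a smaller one.
    g′ v = if does (v ≟ z) then g r₁ else suc (g v)
    f-new : f′ z ≡ suc (f r₁)
    f-new = if-true (dec-true (z ≟ z) refl)
    g-new : g′ z ≡ g r₁
    g-new = if-true (dec-true (z ≟ z) refl)
    f-old : ∀ {v} → v ∈ S → f′ v ≡ f v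
    f-old {v} v∈ = if-false (dec-false (v ≟ z) (∈⇒≢ z∉ v∈ ∘ ≡.sym))
    g-old : ∀ {v} → v ∈ S → g′ v ≡ suc (g v)
    g-old {v} v∈ = if-false (dec-false (v ≟ z) (∈⇒≢ z∉ v∈ ∘ ≡.sym))
    only-r₁ : ∀ {v} → v ∈ S → Adj G z v → v ≡ r₁
    only-r₁ v∈ a with closed z∉ v∈ a
    ... | inj₁ eq   = eq
    ... | inj₂ refl = contradiction a (ear₁ z∉ zr₁)
    f-lip′ : Lipschitz G (z ∷ S) f′
    f-lip′ (here refl) (here refl) a = contradiction refl (Adj⇒≢ G a)
    f-lip′ (here refl) (there v∈) a with refl ← only-r₁ v∈ a = ≤-reflexive (trans f-new (cong suc (≡.sym (f-old v∈))))
    f-lip′ (there u∈) (here refl) a with refl ← only-r₁ u∈ (Adj-sym G a) =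
      ≡.subst₂ (λ x y → x ≤ suc y) (≡.sym (f-old u∈)) (≡.sym f-new) (≤-trans (n≤1+n _) (n≤1+n _))
    f-lip′ (there u∈) (there v∈) a = ≡.subst₂ (λ x y → x ≤ suc y) (≡.sym (f-old u∈)) (≡.sym (f-old v∈)) (f-lip u∈ v∈ a)
    g-lip′ : Lipschitz G (z ∷ S) g′
    g-lip′ (here refl) (here refl) a = contradiction refl (Adj⇒≢ G a)
    g-lip′ (there u∈) (here refl) a with refl ← only-r₁ u∈ (Adj-sym G a) = ≤-reflexive (trans (g-old u∈) (cong suc (≡.sym g-new)))
    g-lip′ (here refl) (there v∈) a with refl ← only-r₁ v∈ a =
      ≡.subst₂ (λ x y → x ≤ suc y) (≡.sym g-new) (≡.sym (g-old v∈)) (≤-trans (n≤1+n _) (n≤1+n _))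
    g-lip′ (there u∈) (there v∈) a = ≡.subst₂ (λ x y → x ≤ suc y) (≡.sym (g-old u∈)) (≡.sym (g-old v∈)) (s≤s (g-lip u∈ v∈ a))
    -- Another neighbour of `r₁` would be a second leaf beside `z`, and forking at the old tip gives
    -- κ + 9 = 2 * (length S + 2).
    no-branch : ∀ {y} → y ∉ z ∷ S → ¬ Adj G y r₁
    no-branch {y} y∉ yr₁ with fork r₁∈ (y∉ ∘ there) z∉ (y∉ ∘ here) yr₁ zr₁ fork₁
    ... | c , conn = critical (complete connected {a = 9} (here refl) (y∉ ∷ᵘ z∉ ∷ᵘ uniq) conn
                       (trans (≡.sym (+-assoc κ 5 4)) (trans (cong (_+ 4) size) (four (length S)))))
      where
      four : ∀ s → 2 * s + 4 ≡ 2 * suc (suc s)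
      four = solve-∀
    closed′ : ∀ {y u} → y ∉ z ∷ S → u ∈ z ∷ S → Adj G y u → u ≡ z ⊎ u ≡ r₂
    closed′ y∉ (here refl) _ = inj₁ refl
    closed′ y∉ (there u∈) a with closed (y∉ ∘ there) u∈ a
    ... | inj₁ refl = contradiction a (no-branch y∉)
    ... | inj₂ eq   = inj₂ eq
    -- The edge would close a cycle through `y`, `x`, `z`, `r₁` and the spine, whose length of at
    -- least 3 makes seven vertices.
    ear₂′ : ∀ {x y} → x ∉ z ∷ S → y ∉ z ∷ S → x ≢ y → Adj G x z → Adj G y r₂ → ¬ Adj G x y
    ear₂′ {x} {y} x∉ y∉ x≢y xz yr₂ xy = 1+n≰n (≤-trans (s≤s (s≤s (s≤s (s≤s spine-long)))) (short-cycles record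
      { start = y ; others = x ∷ z ∷ r₁ ∷ spine ; long = s≤s (s≤s z≤n)
      ; linked = Adj-sym G xy ∷ xz ∷ zr₁ ∷ walk-linked spine-walk
      ; unique = (λ { (here e) → x≢y (≡.sym e) ; (there (here e)) → y∉ (here e)
                    ; (there (there e)) → y∉ (there (All.lookup spine-inside e)) }) ∷ᵘ
                 (λ { (here e) → x∉ (here e) ; (there e) → x∉ (there (All.lookup spine-inside e)) }) ∷ᵘ
                 (λ z∈ → z∉ (All.lookup spine-inside z∈)) ∷ᵘ spine-unique
      ; lastV = r₂ ; ends = walk-end spine-walk ; closes = Adj-sym G yr₂ }))

  -- A certificate that some two vertices are at distance at least n - 3.
  Wide : Set
  Wide = ∃ λ (f : Fin n → ℕ) → ∃₂ λ u v → (∀ {a b} → Adj G a b → f a ≤ suc (f b)) × f v + n ≤ 3 + f u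

  twoTails⇒wide : ∀ {S r₁ r₂} → TwoTails S r₁ r₂ → Wide
  twoTails⇒wide {S} = go n (m≤m+n n (length S))
    where
    go : ∀ d {S r₁ r₂} → n ≤ d + length S → TwoTails S r₁ r₂ → Wide
    go d {S} {r₁} {r₂} le T with full? {G = G} S
    ... | inj₁ full = f , r₁ , r₂ , f-lip (full _) (full _) , ≤-trans (+-monoʳ-≤ (f r₂) (full⇒≤length full)) (≤-reflexive f-gap)
      where open TwoTails T
    go zero le T | inj₂ (v , v∉) = contradiction (≤-trans (unique⇒length≤ (v∉ ∷ᵘ TwoTails.uniq T)) le) 1+n≰n
    go (suc d) {S} le T | inj₂ (v , v∉) with frontier connected (TwoTails.r₁∈ T) v∉
    ... | z , w , z∉ , w∈ , zw with TwoTails.closed T z∉ w∈ zw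
    ...   | inj₁ refl = go d (≤-trans le (≤-reflexive (≡.sym (+-suc d (length S))))) (grow T z∉ zw)
    ...   | inj₂ refl = go d (≤-trans le (≤-reflexive (≡.sym (+-suc d (length S))))) (grow (swap-tails T) z∉ zw)

  module _ {h : Fin 6 → Fin n} (R : Ring G h) where
    open Ring R

    private S = tabulate h

    start-tails : ¬ Short G h → (∀ {z} → z ∉ S → ∀ j → Adj G z (h j) → j ≡ 0F ⊎ j ≡ 3F) → TwoTails S (h 0F) (h 3F)
    start-tails far closed = record
      { uniq = Unique.tabulate⁺ inj ; r₁∈ = h∈ 0F ; r₂∈ = h∈ 3F ; r₁≢r₂ = λ e → 0≢3 (inj e)
      ; size = refl ; fork₁ = hexagon-forkable R
      ; fork₂ = widen-fork (hexagon-forkable (ring-rotate 3F R))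
      ; f = height ∘ preimage h ; g = depth ∘ preimage h
      ; f-lip = height-lipschitz {G = G} inj far ; g-lip = depth-lipschitz {G = G} inj far
      ; f-gap = ≡.cong₂ (λ i j → height i + 6 ≡ 3 + height j) (preimage-f h inj 3F) (preimage-f h inj 0F) ⇐ refl
      ; g-gap = ≡.cong₂ (λ i j → depth i + 6 ≡ 3 + depth j) (preimage-f h inj 0F) (preimage-f h inj 3F) ⇐ refl
      ; closed = closed′
      ; ear₁ = λ z∉ a b → no-ear₃ R (∉⇒out {h = h} z∉) a b
      -- Without tails the cycle closed by this edge has only six vertices, so a colouring must
      -- replace the bound on cycle lengths.
      ; ear₂ = λ x∉ y∉ x≢y a b c → no-long-ear R (∉⇒out {h = h} x∉) a (∉⇒out {h = h} y∉) (x≢y ∘ ≡.sym) b c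
      ; spine-walk = step 0F ∷ step 1F ∷ [ step 2F ]
      ; spine-unique = Unique.map⁺ {f = h} inj spine-distinct
      ; spine-inside = h∈ 0F ∷ h∈ 1F ∷ h∈ 2F ∷ h∈ 3F ∷ []
      ; spine-long = s≤s (s≤s (s≤s z≤n)) }
      where
      h∈ : ∀ i → h i ∈ S
      h∈ i = ∈-tabulate⁺ {f = h} i
      0≢3 : _≢_ {A = Fin 6} 0F 3F
      0≢3 ()
      infix 1 _⇐_
      _⇐_ : {A B : Set} → A ≡ B → B → A
      refl ⇐ b = b
      spine-distinct : Unique {A = Fin 6} (0F ∷ 1F ∷ 2F ∷ 3F ∷ [])
      spine-distinct = from-yes (DecUnique.unique? (_≟_ {6}) (0F ∷ 1F ∷ 2F ∷ 3F ∷ []))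
      closed′ : ∀ {z u} → z ∉ S → u ∈ S → Adj G z u → u ≡ h 0F ⊎ u ≡ h 3F
      closed′ z∉ u∈ a with ∈-tabulate⁻ {f = h} u∈
      ... | j , refl = Sum.map (cong h) (cong h) (closed z∉ j a)
      to : ∀ {u} → u ∈ tabulate (h ∘ rotate 3F) → u ∈ S
      to u∈ with ∈-tabulate⁻ {f = h ∘ rotate 3F} u∈
      ... | j , refl = h∈ (rotate 3F j)
      from : ∀ {u} → u ∈ S → u ∈ tabulate (h ∘ rotate 3F)
      from u∈ with ∈-tabulate⁻ {f = h} u∈
      ... | j , refl = subst (λ i → h i ∈ tabulate (h ∘ rotate 3F)) (opposite j) (∈-tabulate⁺ {f = h ∘ rotate 3F} (rotate 3F j))
        where
        opposite : ∀ (j : Fin 6) → rotate 3F (rotate 3F j) ≡ j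
        opposite = from-yes (all? λ (j : Fin 6) → rotate 3F (rotate 3F j) ≟ j)
      widen-fork : ∀ {k r} → Forkable G k (tabulate (h ∘ rotate 3F)) r → Forkable G k S r
      widen-fork F = record
        { c = c ; α = α ; β = β ; α≢β = α≢β ; r≢α = r≢α ; r≢β = r≢β
        ; conn = λ u∈ v∈ ne → widen to (conn (from u∈) (from v∈) ne)
        ; toα = λ y∈ ne → widen to (toα (from y∈) ne)
        ; toβ = λ y∈ ne → widen to (toβ (from y∈) ne) }
        where open Forkable F

  spans-rotate : ∀ {h : Fin 6 → Fin n} → (∀ v → v ∈ tabulate h) → ∀ i v → v ∈ tabulate (h ∘ rotate i)
  spans-rotate {h} full i v with ∈-tabulate⁻ {f = h} (full v)
  ... | j , refl with surjective i j
    where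
    surjective : ∀ (i j : Fin 6) → ∃ λ d → rotate i d ≡ j
    surjective = from-yes (all? λ (i : Fin 6) → all? λ (j : Fin 6) → any? λ d → rotate i d ≟ j)
  ...   | d , refl = ∈-tabulate⁺ {f = h ∘ rotate i} d

  -- A vertex outside the hexagon supplies a tail, and a tail forces its opposite vertices far
  -- apart. If the hexagon spans `G`, one of its three opposite pairs is far apart, and the
  -- condition on outside vertices is vacuous.
  hexagon-wide : ∀ {h : Fin 6 → Fin n} → Ring G h → Wide
  hexagon-wide {h} R with full? {G = G} (tabulate h)
  ... | inj₂ (v , v∉) = tailed (frontier connected (∈-tabulate⁺ {f = h} zero) v∉)
    where
    tailed : (∃₂ λ z w → z ∉ tabulate h × w ∈ tabulate h × Adj G z w) → Wide
    tailed (x , w , x∉ , w∈ , xw) with ∈-tabulate⁻ {f = h} w∈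
    ... | i , refl = twoTails⇒wide (start-tails R′ (tail⇒long R′ out x0) closed)
      where
      R′ = ring-rotate i R
      out : Out (h ∘ rotate i) x
      out j = ∉⇒out {h = h} x∉ (rotate i j)
      x0 : Adj G x (h (rotate i 0F))
      x0 = subst (Adj G x ∘ h) (≡.sym (rotate-zero i)) xw
      closed : ∀ {z} → z ∉ tabulate (h ∘ rotate i) → ∀ j → Adj G z (h (rotate i j)) → j ≡ 0F ⊎ j ≡ 3F
      closed {z} z∉ j a with z ≟ x
      ... | yes refl = inj₁ (tail-only R′ out x0 j a)
      ... | no z≢x   = inj₂ (other-tail R′ out x0 (∉⇒out {h = h ∘ rotate i} z∉) z≢x j a)
  ... | inj₁ full with short? G h | short? G (h ∘ rotate 1F) | short? G (h ∘ rotate 2F)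
  ...   | no far | _      | _      = twoTails⇒wide (start-tails R far λ z∉ → contradiction (full _) z∉)
  ...   | _      | no far | _      = twoTails⇒wide (start-tails (ring-rotate 1F R) far λ z∉ → contradiction (spans-rotate {h} full 1F _) z∉)
  ...   | _      | _      | no far = twoTails⇒wide (start-tails (ring-rotate 2F R) far λ z∉ → contradiction (spans-rotate {h} full 2F _) z∉)
  ...   | yes s₀ | yes s₁ | yes s₂ = ⊥-elim (not-all-short R s₀ s₁ s₂)

  hexagon-diam : ∀ {h : Fin 6 → Fin n} {D} → Ring G h → Diam G D → n ≤ 3 + D
  hexagon-diam R diam = let f , u , v , lip , gap = hexagon-wide R in lipschitz⇒diam≥ lip gap diam

-- Distance bound and conclusion

module _ {n : ℕ} {G : Graph n} where

  -- A path of D edges shows 2D - 1 distinct colours if D is positive; stating this as 2D ≤ k + 1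
  -- covers D = 0 too.
  trConnected⇒dist≤ : ∀ {k D u v} → TRConnected G k → Dist G u v D → 2 * D ≤ suc k
  trConnected⇒dist≤ {k} {D} {u} {v} (c , conn) (_ , shortest) with u ≟ v
  ... | yes refl = ≤-trans (≤-reflexive (cong (2 *_) (n≤0⇒n≡0 (shortest trivial)))) z≤n
    where
    trivial : Path G u u
    trivial = record { rest = [] ; linked = [-] ; unique = [] ∷ [] ; ends = refl }
  ... | no u≢v = let P , rb = conn u v u≢v in
      ≤-trans (*-monoʳ-≤ 2 (shortest P)) (bound (rest P) (linked P) (ends P) rb)
    where
    bound : ∀ xs → Linked (Adj G) (u ∷ xs) → End G u xs v → Unique (pathColors G c u xs) → 2 * length xs ≤ suc k
    bound []       _ e _ = contradiction e u≢v
    bound (x ∷ xs) l e d = ≤-trans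
      (≤-reflexive (trans (cong (suc (length xs) +_) (+-identityʳ _)) (≡.sym (walk-length (toWalk l e)))))
      (s≤s (unique⇒length≤ d))

  cycle⇒ring : (C : Cycle G) → cycleLength G C ≡ suc m → ∃ λ (h : Fin (suc m) → Fin n) → Ring G h
  cycle⇒ring C refl = _ , cycle-ring C

  ring⇒≤n : ∀ {h : Fin (suc m) → Fin n} → Ring G h → suc m ≤ n
  ring⇒≤n {h = h} R = subst (_≤ n) (length-tabulate h) (unique⇒length≤ (Unique.tabulate⁺ (Ring.inj R)))

  hexagon-trc : ∀ {h : Fin 6 → Fin n} → Connected G → Ring G h → TRConnected G (2 * n ∸ 7)
  hexagon-trc {h = h} connected R = use-pattern connected hexagon 3 7 h inj
    (step 0F ∷ step 1F ∷ step 2F ∷ step 3F ∷ step 4F ∷ step 5F ∷ []) refl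
    where open Ring R

-- The bounds give 2D ≤ 2n - 6, and D = n - 3 pushes `t` up to 2n - 7. Writing n = 6 + p makes the
-- truncated subtractions exact.
squeeze : ∀ {n D t} → 6 ≤ n → 2 * D ≤ suc t → t ≤ 2 * n ∸ 7 → D ≤ n ∸ 3 × (D ≡ n ∸ 3 → 2 * n ∸ 7 ≤ t)
squeeze {D = D} {t} 6≤n lower upper with m≤n⇒∃[o]m+o≡n 6≤n
... | p , refl =
    *-cancelˡ-≤ 2 (≤-trans lower (≤-trans (s≤s upper) (≤-reflexive (trans (cong suc 2n∸7) (≡.sym (2[3+p] p)))))) ,
    λ D≡ → subst (_≤ t) (≡.sym 2n∸7) (≤-pred (subst (_≤ suc t) (trans (cong (2 *_) D≡) (2[3+p] p)) lower))
  where
  2[6+p] : ∀ p → 2 * (6 + p) ≡ 7 + (5 + 2 * p)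
  2[6+p] = solve-∀
  2[3+p] : ∀ p → 2 * (3 + p) ≡ 6 + 2 * p
  2[3+p] = solve-∀
  2n∸7 : 2 * (6 + p) ∸ 7 ≡ 5 + 2 * p
  2n∸7 = trans (cong (_∸ 7) (2[6+p] p)) (m+n∸m≡n 7 (5 + 2 * p))

theorem3p5 : (n : ℕ) (G : Graph n) → Connected G → AtLeastTwoCycles G →
    (ℓ : ℕ) → Circumference G ℓ → 6 ≤ ℓ →
    (D : ℕ) → Diam G D →
    (t : ℕ) → IsTrc G t →
    ((ℓ ≡ 6 × D ≡ n ∸ 3) → t ≡ 2 * n ∸ 7)
    × (¬ (ℓ ≡ 6 × D ≡ n ∸ 3) → t ≤ 2 * n ∸ 9)
theorem3p5 n G connected twoCycles ℓ ((C , C-length) , maximal) 6≤ℓ D diam@(_ , _ , _ , distD) t (tr , least)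
  with m≤n⇒∃[o]m+o≡n 6≤ℓ
... | q , refl = (λ (ℓ≡6 , D≡) → exact (proj₂ (cycle⇒ring C (trans C-length ℓ≡6))) D≡) , otherwise q C-length maximal
  where
  upper : ∀ {k} → TRConnected G k → t ≤ k
  upper {k} trk = ≮⇒≥ λ k<t → least k k<t trk

  lower : 2 * D ≤ suc t
  lower = trConnected⇒dist≤ tr distD

  by-contradiction : (¬ TRConnected G (2 * n ∸ 9) → ⊥) → t ≤ 2 * n ∸ 9
  by-contradiction absurd = decidable-stable (t ≤? 2 * n ∸ 9) λ t≰ → absurd (t≰ ∘ upper)

  exact : {h : Fin 6 → Fin n} → Ring G h → D ≡ n ∸ 3 → t ≡ 2 * n ∸ 7
  exact R D≡ = ≤-antisym t≤ (proj₂ (squeeze (ring⇒≤n R) lower t≤) D≡)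
    where
    t≤ : t ≤ 2 * n ∸ 7
    t≤ = upper (hexagon-trc connected R)

  otherwise : ∀ q → cycleLength G C ≡ 6 + q → (∀ C → cycleLength G C ≤ 6 + q) →
              ¬ (6 + q ≡ 6 × D ≡ n ∸ 3) → t ≤ 2 * n ∸ 9
  otherwise 0 C-length maximal ¬exact = by-contradiction λ critical →
    -- The colouring with 2n - 7 colours bounds D by n - 3 from above, and criticality bounds it by
    -- n - 3 from below.
    ¬exact (refl , ≤-antisym (proj₁ (squeeze (ring⇒≤n R) lower (upper (hexagon-trc connected R))))
                             (m≤n+o⇒m∸n≤o n 3 (CriticalHexagon.hexagon-diam connected critical maximal R diam)))
    where
    R = proj₂ (cycle⇒ring C C-length)
  otherwise 1 C-length _ _ = by-contradiction λ critical →
    CriticalHeptagon.heptagon-impossible connected critical twoCycles (proj₂ (cycle⇒ring C C-length))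
  otherwise 2 C-length _ _ = upper (octagon-trc connected (proj₂ (cycle⇒ring C C-length)))
  otherwise (suc (suc (suc q))) C-length _ _ =
    -- The cyclic colouring has deficit `ℓ`, here 9 + `q`.
    ≤-trans (upper (ring-trc connected (proj₂ (cycle⇒ring C C-length)))) (∸-monoʳ-≤ (2 * n) (m≤m+n 9 q))
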